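{- Over the standard structure $\mathbb{N}$ of arithmetic, a relation $X\subseteq\mathbb{N}^k$ is definable by a formula of $\mathrm{SCL}$ (i.e., there is $\varphi(x_1,\dots,x_k)$ of $\mathrm{SCL}$ with $(m_1,\dots,m_k)\in X$ iff $\mathbb{N},[m_i/x_i]\models\varphi$) if and only if $X$ is a $\Pi^1_1$-relation.
   Context: A relation $X\subseteq\mathbb{N}^k$ is $\Pi^1_1$ if there is a formula $\forall X_1\dots\forall X_n\,\psi(x_1,\dots,x_k)$ of universal second-order logic ($X_i$ relation variables, $\psi$ first-order) over the vocabulary of arithmetic such that $(m_1,\dots,m_k)\in X$ iff $\mathbb{N}\models\forall X_1\dots\forall X_n\,\psi(m_1,\dots,m_k)$. Syntax of $\mathrm{SCL}$. $\mathrm{FO}$ has equality and $\bot$ as primitives and $\neg,\wedge,\vee,\exists,\forall$. Fix label symbols $L_0,L_1,\dots$ and for each $L$ a claim symbol $C_L$. Formulas: $\mathrm{FO}$ formation rules plus: each $C_L$ is atomic (no free variables); if $\varphi$ is a formula, $L\varphi$ is a formula (same free variables). FO-atoms are atomic formulas of $\mathrm{FO}$. The reference formula of an occurrence of $C_L$ is the subformula occurrence $L\psi$ above it in the syntax tree with no occurrence of $L$ strictly between (if any). Semantics. $\mathcal{G}_\infty(\mathfrak{A},s,\varphi)$ has positions $(\psi,r,\#)$, $\#\in\{+,-\}$, starting at $(\varphi,s,+)$. FO-atom $\alpha$: if $\#=+$ Eloise wins iff $\mathfrak{A},r\models\alpha$, else Abelard; if $\#=-$ Abelard wins iff $\mathfrak{A},r\models\alpha$,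 else Eloise. $\neg$ flips the sign. $\wedge$: Abelard chooses if $+$, Eloise if $-$. $\vee$: Eloise if $+$, Abelard if $-$. $\forall x$: Abelard picks $a\in A$ if $+$, Eloise if $-$, assignment becomes $r[a/x]$. $\exists x$: Eloise if $+$, Abelard if $-$. $L\psi$: move to $\psi$. $C_L$: move to its reference formula (no winner if none). Infinite plays have no winner. $\mathfrak{A},s\models\varphi$ iff Eloise has a winning strategy. -}

module Defs where

open import Level using (0ℓ)
open import Data.Nat using (ℕ; zero; suc; _+_; _*_; _<_; _≡ᵇ_; _<ᵇ_)
open import Data.Bool using (Bool; true; false; if_then_else_; T; not)
open import Data.Fin using (Fin)
open import Data.Vec using (Vec; []; _∷_)
import Data.Vec as Vec
open import Data.List using (List; []; _∷_; length; map; upTo)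
import Data.List as List
open import Data.Maybe using (Maybe; just; nothing)
open import Data.Product using (Σ; _×_; _,_; ∃)
open import Data.Sum using (_⊎_)
open import Data.Unit using (⊤)
open import Data.Empty using (⊥)
open import Relation.Nullary using (¬_)
open import Relation.Binary.PropositionalEquality using (_≡_)
open import Function.Bundles using (_⇔_)

data Term : Set where
  var  : ℕ → Term
  𝟘 𝟙  : Term
  _⊕_ _⊗_ : Term → Term → Term

Assignment : Set
Assignment = ℕ → ℕ

⟦_⟧ : Term → Assignment → ℕ
⟦ var x ⟧ r = r x
⟦ 𝟘 ⟧ r = 0
⟦ 𝟙 ⟧ r = 1
⟦ t ⊕ u ⟧ r = ⟦ t ⟧ r + ⟦ u ⟧ r
⟦ t ⊗ u ⟧ r = ⟦ t ⟧ r * ⟦ u ⟧ r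

_[_/_] : Assignment → ℕ → ℕ → Assignment
(r [ a / x ]) y = if y ≡ᵇ x then a else r y

TermIn : (ℕ → Set) → Term → Set
TermIn P (var x) = P x
TermIn P 𝟘 = ⊤
TermIn P 𝟙 = ⊤
TermIn P (t ⊕ u) = TermIn P t × TermIn P u
TermIn P (t ⊗ u) = TermIn P t × TermIn P u

Label : Set
Label = ℕ

data SCL : Set where
  _≐_ _≺_ : Term → Term → SCL
  falsum  : SCL
  ¬ˢ_     : SCL → SCL
  _∧ˢ_ _∨ˢ_ : SCL → SCL → SCL
  ∃ˢ ∀ˢ   : ℕ → SCL → SCL
  claim   : Label → SCL
  lab     : Label → SCL → SCL

SCLFreeIn : (ℕ → Set) → SCL → Set
SCLFreeIn P (t ≐ u) = TermIn P t × TermIn P u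
SCLFreeIn P (t ≺ u) = TermIn P t × TermIn P u
SCLFreeIn P falsum = ⊤
SCLFreeIn P (¬ˢ φ) = SCLFreeIn P φ
SCLFreeIn P (φ ∧ˢ ψ) = SCLFreeIn P φ × SCLFreeIn P ψ
SCLFreeIn P (φ ∨ˢ ψ) = SCLFreeIn P φ × SCLFreeIn P ψ
SCLFreeIn P (∃ˢ x φ) = SCLFreeIn (λ y → y ≡ x ⊎ P y) φ
SCLFreeIn P (∀ˢ x φ) = SCLFreeIn (λ y → y ≡ x ⊎ P y) φ
SCLFreeIn P (claim L) = ⊤
SCLFreeIn P (lab L φ) = SCLFreeIn P φ

-- The game G_∞(ℕ, s, φ).
-- A subformula occurrence is represented by the subformula together with
-- an environment recording, for each label, the nearest enclosing
-- occurrence  L ψ  (i.e. the reference formula), itself given as the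
-- formula ψ together with its own environment.

data Env : Set where
  ε    : Env
  bind : Label → SCL → Env → Env → Env
  -- bind L ψ e rest : label L refers to the occurrence (L ψ) whose
  -- environment is e; other labels are looked up in rest.

refOf : Label → Env → Maybe (SCL × Env)
refOf L ε = nothing
refOf L (bind L' ψ e rest) = if L ≡ᵇ L' then just (ψ , e) else refOf L rest

data Sign : Set where
  + - : Sign

flip : Sign → Sign
flip + = -
flip - = +

data Player : Set where
  eloise abelard : Player

record Position : Set where
  constructor ⟨_,_,_,_⟩
  field
    formula : SCL
    env     : Env
    asg     : Assignment
    sign    : Sign

data Step : Set where
  win   : Player → Step
  stuck : Step
  auto  : Position → Step
  pick₂ : Player → Position → Position → Step
  pickℕ : Player → (ℕ → Position) → Step

atomStep : Bool → Sign → Step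
atomStep b + = if b then win eloise else win abelard
atomStep b - = if b then win abelard else win eloise

owner : Sign → Player → Player
owner + p = p
owner - eloise = abelard
owner - abelard = eloise

step : Position → Step
step ⟨ t ≐ u , e , r , s ⟩ = atomStep (⟦ t ⟧ r ≡ᵇ ⟦ u ⟧ r) s
step ⟨ t ≺ u , e , r , s ⟩ = atomStep (⟦ t ⟧ r <ᵇ ⟦ u ⟧ r) s
step ⟨ falsum , e , r , s ⟩ = atomStep false s
step ⟨ ¬ˢ φ , e , r , s ⟩ = auto ⟨ φ , e , r , flip s ⟩
step ⟨ φ ∧ˢ ψ , e , r , s ⟩ = pick₂ (owner s abelard) ⟨ φ , e , r , s ⟩ ⟨ ψ , e , r , s ⟩
step ⟨ φ ∨ˢ ψ , e , r , s ⟩ = pick₂ (owner s eloise) ⟨ φ , e , r , s ⟩ ⟨ ψ , e , r , s ⟩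
step ⟨ ∀ˢ x φ , e , r , s ⟩ = pickℕ (owner s abelard) (λ a → ⟨ φ , e , r [ a / x ] , s ⟩)
step ⟨ ∃ˢ x φ , e , r , s ⟩ = pickℕ (owner s eloise) (λ a → ⟨ φ , e , r [ a / x ] , s ⟩)
step ⟨ lab L φ , e , r , s ⟩ = auto ⟨ φ , bind L φ e e , r , s ⟩
step ⟨ claim L , e , r , s ⟩ with refOf L e
... | just (ψ , e') = auto ⟨ lab L ψ , e' , r , s ⟩
... | nothing = stuck

EChoice : Step → Set
EChoice (pick₂ eloise _ _) = Bool
EChoice (pickℕ eloise _) = ℕ
EChoice _ = ⊤

Next : (s : Step) → EChoice s → Position → Set
Next (win _) _ p' = ⊥
Next stuck _ p' = ⊥
Next (auto q) _ p' = p' ≡ q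
Next (pick₂ eloise q q') b p' = p' ≡ (if b then q else q')
Next (pick₂ abelard q q') _ p' = p' ≡ q ⊎ p' ≡ q'
Next (pickℕ eloise f) n p' = p' ≡ f n
Next (pickℕ abelard f) _ p' = ∃ λ n → p' ≡ f n

-- strategies of Eloise: functions of the history (earlier positions, in
-- order) and the current position
Strategy : Set
Strategy = List Position → (p : Position) → EChoice (step p)

history : (ℕ → Position) → ℕ → List Position
history ρ i = map ρ (upTo i)

ConsistentStep : Strategy → (ℕ → Position) → ℕ → Set
ConsistentStep σ ρ i = Next (step (ρ i)) (σ (history ρ i) (ρ i)) (ρ (suc i))

Terminal : Step → Set
Terminal (win _) = ⊤
Terminal stuck = ⊤
Terminal _ = ⊥

-- σ is winning from p₀: there is no infinite play consistent with σ
-- (infinite plays have no winner), and every finite maximal play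
-- consistent with σ ends in a position won by Eloise.
Winning : Position → Strategy → Set
Winning p₀ σ =
  (∀ (ρ : ℕ → Position) → ρ 0 ≡ p₀ → ¬ (∀ i → ConsistentStep σ ρ i))
  × (∀ (ρ : ℕ → Position) (n : ℕ) → ρ 0 ≡ p₀
       → (∀ i → i < n → ConsistentStep σ ρ i)
       → Terminal (step (ρ n)) → step (ρ n) ≡ win eloise)

_⊨ˢ_ : Assignment → SCL → Set
s ⊨ˢ φ = Σ Strategy (Winning ⟨ φ , ε , s , + ⟩)

-- The assignment [m_i / x_i] for a tuple m (x_1..x_k are the variables
-- 0..k-1; other variables get the irrelevant default 0).

tupleAsg : ∀ {k} → Vec ℕ k → Assignment
tupleAsg [] _ = 0
tupleAsg (a ∷ m) zero = a
tupleAsg (a ∷ m) (suc i) = tupleAsg m i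

SCLDefinable : (k : ℕ) → (Vec ℕ k → Set) → Set
SCLDefinable k X =
  Σ SCL λ φ → SCLFreeIn (λ y → y < k) φ × (∀ m → X m ⇔ (tupleAsg m ⊨ˢ φ))

-- Π¹₁ relations: ∀X₁…∀Xₙ ψ with ψ first-order over arithmetic plus the
-- relation variables X_j of arity ar_j.

data SOF (ar : List ℕ) : Set where
  _≐_ _≺_ : Term → Term → SOF ar
  falsum  : SOF ar
  rel     : (j : Fin (length ar)) → Vec Term (List.lookup ar j) → SOF ar
  ¬ᶠ_     : SOF ar → SOF ar
  _∧ᶠ_ _∨ᶠ_ : SOF ar → SOF ar → SOF ar
  ∃ᶠ ∀ᶠ   : ℕ → SOF ar → SOF ar

SOFFreeIn : ∀ {ar} → (ℕ → Set) → SOF ar → Set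
SOFFreeIn P (t ≐ u) = TermIn P t × TermIn P u
SOFFreeIn P (t ≺ u) = TermIn P t × TermIn P u
SOFFreeIn P falsum = ⊤
SOFFreeIn P (rel j ts) = Vec.foldr (λ _ → Set) (λ t A → TermIn P t × A) ⊤ ts
SOFFreeIn P (¬ᶠ φ) = SOFFreeIn P φ
SOFFreeIn P (φ ∧ᶠ ψ) = SOFFreeIn P φ × SOFFreeIn P ψ
SOFFreeIn P (φ ∨ᶠ ψ) = SOFFreeIn P φ × SOFFreeIn P ψ
SOFFreeIn P (∃ᶠ x φ) = SOFFreeIn (λ y → y ≡ x ⊎ P y) φ
SOFFreeIn P (∀ᶠ x φ) = SOFFreeIn (λ y → y ≡ x ⊎ P y) φ

RelAsg : List ℕ → Set
RelAsg ar = (j : Fin (length ar)) → Vec ℕ (List.lookup ar j) → Bool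

-- Tarskian satisfaction of first-order formulas (classical when excluded
-- middle is assumed)
Sat : ∀ {ar} → RelAsg ar → Assignment → SOF ar → Set
Sat R r (t ≐ u) = ⟦ t ⟧ r ≡ ⟦ u ⟧ r
Sat R r (t ≺ u) = ⟦ t ⟧ r < ⟦ u ⟧ r
Sat R r falsum = ⊥
Sat R r (rel j ts) = T (R j (Vec.map (λ t → ⟦ t ⟧ r) ts))
Sat R r (¬ᶠ φ) = ¬ Sat R r φ
Sat R r (φ ∧ᶠ ψ) = Sat R r φ × Sat R r ψ
Sat R r (φ ∨ᶠ ψ) = Sat R r φ ⊎ Sat R r ψ
Sat R r (∃ᶠ x φ) = Σ ℕ λ a → Sat R (r [ a / x ]) φ
Sat R r (∀ᶠ x φ) = (a : ℕ) → Sat R (r [ a / x ]) φ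

SatΠ¹₁ : ∀ {ar} → Assignment → SOF ar → Set
SatΠ¹₁ {ar} r ψ = (R : RelAsg ar) → Sat R r ψ

IsΠ¹₁ : (k : ℕ) → (Vec ℕ k → Set) → Set
IsΠ¹₁ k X =
  Σ (List ℕ) λ ar → Σ (SOF ar) λ ψ →
    SOFFreeIn (λ y → y < k) ψ × (∀ m → X m ⇔ SatΠ¹₁ (tupleAsg m) ψ)

{-# OPTIONS --safe #-}
module Submission where

-- Eloise has a winning strategy iff the position belongs to the inductively
-- generated set Win; the theorem is then about this least fixed point.
--
-- From SCL to Π¹₁: only positions at labelled formulas need to be remembered.
-- Eloise wins iff every set of (codes of) such positions that is closed under
-- the rules of the game forces the initial position, and this is Π¹₁.
--
-- From Π¹₁ to SCL: to verify ∀X ψ, Eloise interrogates Abelard about a putative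
-- counterexample X.  In each round she asks whether X holds of some tuple, or
-- whether some quantified subformula of ψ is true (and with which witness), and
-- the answer is appended to a history coded by a number.  She wins when the
-- answers make ψ true or contradict each other.  Truthful answers about a
-- counterexample never lose, and conversely answers to all questions that are
-- never caught define a counterexample.  The history is coded by a polynomial
-- pairing and searched by a loop of the game, so no arithmetisation of sequences
-- is needed.

open import Defs renaming (+ to pos; - to neg)
open import Level using (0ℓ)
open import Data.Nat using (ℕ; zero; suc; _+_; _*_; _⊔_; _≤_; _<_; _≡ᵇ_; _<ᵇ_; _≟_; _<?_; z≤n; s≤s; z<s; s<s)
open import Data.Nat.Properties using
  ( *-mono-≤; *-monoʳ-<; +-cancelˡ-≡; +-comm; +-identityʳ; +-monoʳ-≤; +-suc; <-cmp; <-≤-trans;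
    <ᵇ⇒<; <⇒<ᵇ; <⇒≢; <⇒≤; m<n⇒m<1+n; m<n⇒m<n⊔o; m<n⇒m<o⊔n; m≢1+n+m; m≤m+n; m≤m⊔n; m≤n+m;
    m≤n⇒m<n∨m≡n; m≤n⇒m≤1+n; m≤n⊔m; m⊔n≤o⇒m≤o; m⊔n≤o⇒n≤o; n<1+n; suc-injective; ≡ᵇ⇒≡; ≡⇒≡ᵇ;
    ≤-refl; ≤-reflexive; ≤-trans; ⊔-lub; module ≤-Reasoning )
open import Data.Nat.Induction using (<-rec)
open import Data.Bool using (Bool; true; false; T)
open import Data.Fin using (Fin; zero; toℕ; fromℕ<)
open import Data.Fin.Properties using (toℕ<n; fromℕ<-toℕ; toℕ-injective)
open import Data.List using (List; []; _∷_; _∷ʳ_; length; lookup; applyUpTo)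
open import Data.List.Properties using (map-upTo; applyUpTo-∷ʳ)
open import Data.Vec using (Vec; []; _∷_)
import Data.Vec as Vec
open import Data.Maybe using (just; nothing)
open import Data.Product using (Σ; _×_; _,_; ∃; proj₁; proj₂; map₂)
open import Data.Sum using (_⊎_; inj₁; inj₂)
open import Data.Unit using (⊤; tt)
open import Data.Empty using (⊥; ⊥-elim)
open import Relation.Nullary using (¬_; Dec; yes; no)
open import Relation.Nullary.Decidable using (⌊_⌋; toWitness; fromWitness)
open import Relation.Binary.Definitions using (tri<; tri≈; tri>)
open import Relation.Binary.PropositionalEquality using (_≡_; _≢_; refl; sym; trans; cong; cong₂; subst; subst₂)
open import Axiom.ExcludedMiddle using (ExcludedMiddle)
open import Function using (_∘_; id)
open import Function.Bundles using (_⇔_; mk⇔; module Equivalence)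
open import Function.Construct.Composition using (_⇔-∘_)
open Equivalence using (to; from)

-- Winning strategies and the inductively generated winning set.

data Win : Step → Set where
  won   : Win (win eloise)
  move  : ∀ {p} → Win (step p) → Win (auto p)
  left  : ∀ {p q} → Win (step p) → Win (pick₂ eloise p q)
  right : ∀ {p q} → Win (step q) → Win (pick₂ eloise p q)
  both  : ∀ {p q} → Win (step p) → Win (step q) → Win (pick₂ abelard p q)
  some  : ∀ {f} n → Win (step (f n)) → Win (pickℕ eloise f)
  every : ∀ {f} → (∀ n → Win (step (f n))) → Win (pickℕ abelard f)

Safe : Step → Set
Safe s = Terminal s → s ≡ win eloise

-- The same inductive set in a form uniform in the kind of step, which is what
-- a strategy replaying a history needs.
data Tree (s : Step) : Set where
  node : Safe s → (c : EChoice s) → (∀ p → Next s c p → Tree (step p)) → Tree s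

tree : ∀ {s} → Win s → Tree s
tree won          = node (λ _ → refl) tt λ _ ()
tree (move w)     = node (λ ()) tt λ { _ refl → tree w }
tree (left w)     = node (λ ()) true λ { _ refl → tree w }
tree (right w)    = node (λ ()) false λ { _ refl → tree w }
tree (both w w′)  = node (λ ()) tt λ { _ (inj₁ refl) → tree w ; _ (inj₂ refl) → tree w′ }
tree (some n w)   = node (λ ()) n λ { _ refl → tree w }
tree (every w)    = node (λ ()) tt λ { _ (n , refl) → tree (w n) }

choice : ∀ {s} → Tree s → EChoice s
choice (node _ c _) = c

safe : ∀ {s} → Tree s → Safe s
safe (node f _ _) = f

anyChoice : ∀ s → EChoice s
anyChoice (win _)           = tt
anyChoice stuck             = tt
anyChoice (auto _)          = tt
anyChoice (pick₂ eloise _ _)  = true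
anyChoice (pick₂ abelard _ _) = tt
anyChoice (pickℕ eloise _)  = 0
anyChoice (pickℕ abelard _) = tt

module Games (em : ExcludedMiddle 0ℓ) where

  stable : {A : Set} → ¬ ¬ A → A
  stable {A} nn with em {A}
  ... | yes a = a
  ... | no na = ⊥-elim (nn na)

  ¬∀⇒∃¬ : {A : Set} {P : A → Set} → ¬ (∀ a → P a) → Σ A λ a → ¬ P a
  ¬∀⇒∃¬ n = stable λ k → n λ a → stable λ np → k (a , np)

  -- The tree sits one move before the first position of the history, so the current position is
  -- reached by a further move even when the history is empty. Off the tree the choice is arbitrary,
  -- as no consistent play from the root gets there.
  replay : ∀ {s} → Tree s → List Position → (p : Position) → EChoice (step p)
  replay {s} (node _ c k) [] p with em {Next s c p}
  ... | yes n = choice (k p n)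
  ... | no _  = anyChoice (step p)
  replay {s} (node _ c k) (q ∷ h) p with em {Next s c q}
  ... | yes n = replay (k q n) h p
  ... | no _  = anyChoice (step p)

  Follows : ∀ {s} → Tree s → (ℕ → Position) → ℕ → Set
  Follows w ρ i = Next (step (ρ i)) (replay w (applyUpTo ρ i) (ρ i)) (ρ (suc i))

  -- Every round of a consistent play descends one level in the well-founded tree, so structural
  -- recursion on `w` rules out an infinite play.
  replay-finite : ∀ {s} (w : Tree s) ρ → Next s (choice w) (ρ 0) → ¬ (∀ i → Follows w ρ i)
  replay-finite {s} (node _ c k) ρ n follows
    with em {Next s c (ρ 0)} | follows 0 | (λ i → follows (suc i))
  ... | yes n′ | first | later = replay-finite (k (ρ 0) n′) (ρ ∘ suc) first later
  ... | no ¬n  | _     | _     = ¬n n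

  replay-safe : ∀ {s} (w : Tree s) ρ n → Next s (choice w) (ρ 0) →
                (∀ i → i < n → Follows w ρ i) → Safe (step (ρ n))
  replay-safe {s} (node _ c k) ρ zero nx _ = safe (k (ρ 0) nx)
  replay-safe {s} (node _ c k) ρ (suc n) nx follows
    with em {Next s c (ρ 0)} | follows 0 z<s | (λ i i<n → follows (suc i) (s<s i<n))
  ... | yes n′ | first | later = replay-safe (k (ρ 0) n′) (ρ ∘ suc) n first later
  ... | no ¬n  | _     | _     = ⊥-elim (¬n nx)

  Win⇒winning : ∀ p → Win (step p) → Σ Strategy (Winning p)
  Win⇒winning p w = replay w₀ , infinite , finite
    where
    -- The artificial move `auto p` supplies the level above `p` that `replay` expects.
    w₀ : Tree (auto p)
    w₀ = tree (move w)
    follows : ∀ ρ i → ConsistentStep (replay w₀) ρ i → Follows w₀ ρ i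
    follows ρ i = subst (λ h → Next (step (ρ i)) (replay w₀ h (ρ i)) (ρ (suc i))) (map-upTo ρ i)
    infinite : ∀ ρ → ρ 0 ≡ p → ¬ (∀ i → ConsistentStep (replay w₀) ρ i)
    infinite ρ eq con = replay-finite w₀ ρ eq λ i → follows ρ i (con i)
    finite : ∀ ρ n → ρ 0 ≡ p → (∀ i → i < n → ConsistentStep (replay w₀) ρ i) → Safe (step (ρ n))
    finite ρ n eq con = replay-safe w₀ ρ n eq λ i i<n → follows ρ i (con i i<n)

  -- Each non-terminal case is the contrapositive of a constructor of `Win`; excluded middle finds
  -- the move where Abelard chooses. `Safe` disposes of the terminal steps that Eloise does not win.
  unwon-step : ∀ s → Safe s → ¬ Win s → (c : EChoice s) →
               Σ Position λ p → Next s c p × ¬ Win (step p)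
  unwon-step (win eloise) _ ¬w _ = ⊥-elim (¬w won)
  unwon-step (win abelard) f _ _ with f tt
  ... | ()
  unwon-step stuck f _ _ with f tt
  ... | ()
  unwon-step (auto p) _ ¬w _ = p , refl , ¬w ∘ move
  unwon-step (pick₂ eloise p q) _ ¬w true = p , refl , ¬w ∘ left
  unwon-step (pick₂ eloise p q) _ ¬w false = q , refl , ¬w ∘ right
  unwon-step (pick₂ abelard p q) _ ¬w _ with em {Win (step p)}
  ... | yes w = q , inj₂ refl , ¬w ∘ both w
  ... | no ¬p = p , inj₁ refl , ¬p
  unwon-step (pickℕ eloise f) _ ¬w n = f n , refl , ¬w ∘ some n
  unwon-step (pickℕ abelard f) _ ¬w _ with ¬∀⇒∃¬ (¬w ∘ every)
  ... | n , ¬p = f n , (n , refl) , ¬p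

  module Unwon (p₀ : Position) (σ : Strategy) (¬w₀ : ¬ Win (step p₀)) where
    Unwon : Set
    Unwon = Σ Position λ p → ¬ Win (step p)

    -- At a position that is not safe the play is over; repeating the position is a junk value that
    -- keeps `state` total.
    advance : List Position → Unwon → Unwon
    advance h (p , ¬w) with em {Safe (step p)}
    ... | yes f with unwon-step (step p) f ¬w (σ h p)
    ...   | q , _ , ¬w′ = q , ¬w′
    advance h (p , ¬w) | no _ = p , ¬w

    advance-next : ∀ h u → Safe (step (proj₁ u)) →
                   Next (step (proj₁ u)) (σ h (proj₁ u)) (proj₁ (advance h u))
    advance-next h (p , ¬w) f with em {Safe (step p)}
    ... | yes f′ with unwon-step (step p) f′ ¬w (σ h p)
    ...   | _ , nx , _ = nx
    advance-next h (p , ¬w) f | no ¬f = ⊥-elim (¬f f)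

    state : ℕ → List Position × Unwon
    state zero = [] , p₀ , ¬w₀
    state (suc n) with state n
    ... | h , u = h ∷ʳ proj₁ u , advance h u

    play : ℕ → Position
    play n = proj₁ (proj₂ (state n))

    state-history : ∀ n → proj₁ (state n) ≡ applyUpTo play n
    state-history zero = refl
    state-history (suc n) =
      trans (cong (_∷ʳ play n) (state-history n)) (applyUpTo-∷ʳ play n)

    play-consistent : ∀ n → Safe (step (play n)) → ConsistentStep σ play n
    play-consistent n f =
      subst (λ h → Next (step (play n)) (σ h (play n)) (play (suc n)))
            (trans (state-history n) (sym (map-upTo play n)))
            (advance-next (proj₁ (state n)) (proj₂ (state n)) f)

    ¬winning : ¬ Winning p₀ σ
    ¬winning (infinite , finite) = infinite play refl
      -- Round `n` is consistent once its position is safe, and `finite` derives safety from the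
      -- consistency of all earlier rounds; hence course-of-values induction.
      (<-rec _ λ n con → play-consistent n (finite play n refl λ i i<n → con i<n))

  winning⇔Win : ∀ p → Σ Strategy (Winning p) ⇔ Win (step p)
  winning⇔Win p = mk⇔ (λ { (σ , w) → stable λ ¬w → Unwon.¬winning p σ ¬w w }) (Win⇒winning p)

-- Assignments, variable bounds and congruence.

update-same : ∀ r a x → (r [ a / x ]) x ≡ a
update-same r a x with x ≡ᵇ x | ≡⇒≡ᵇ x x refl
... | true | _ = refl

update-other : ∀ r a {x y} → y ≢ x → (r [ a / x ]) y ≡ r y
update-other r a {x} {y} y≢x with y ≡ᵇ x | ≡ᵇ⇒≡ y x
... | false | _ = refl
... | true  | y≡x = ⊥-elim (y≢x (y≡x tt))

Agree : ℕ → Assignment → Assignment → Set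
Agree N r r′ = ∀ {i} → i < N → r i ≡ r′ i

Agree-sym : ∀ {N r r′} → Agree N r r′ → Agree N r′ r
Agree-sym ag i<N = sym (ag i<N)

Agree-update : ∀ {N r r′} a x → Agree N r r′ → Agree N (r [ a / x ]) (r′ [ a / x ])
Agree-update a x ag {i} i<N with i ≡ᵇ x
... | true  = refl
... | false = ag i<N

-- Strict upper bounds for all variables, free or bound.

varsᵗ : Term → ℕ
varsᵗ (var x) = suc x
varsᵗ 𝟘 = 0
varsᵗ 𝟙 = 0
varsᵗ (t ⊕ u) = varsᵗ t ⊔ varsᵗ u
varsᵗ (t ⊗ u) = varsᵗ t ⊔ varsᵗ u

varsᵛ : ∀ {n} → Vec Term n → ℕ
varsᵛ [] = 0
varsᵛ (t ∷ ts) = varsᵗ t ⊔ varsᵛ ts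

varsˢ : SCL → ℕ
varsˢ (t ≐ u) = varsᵗ t ⊔ varsᵗ u
varsˢ (t ≺ u) = varsᵗ t ⊔ varsᵗ u
varsˢ falsum = 0
varsˢ (¬ˢ φ) = varsˢ φ
varsˢ (φ ∧ˢ ψ) = varsˢ φ ⊔ varsˢ ψ
varsˢ (φ ∨ˢ ψ) = varsˢ φ ⊔ varsˢ ψ
varsˢ (∃ˢ x φ) = suc x ⊔ varsˢ φ
varsˢ (∀ˢ x φ) = suc x ⊔ varsˢ φ
varsˢ (claim L) = 0
varsˢ (lab L φ) = varsˢ φ

varsᶠ : ∀ {ar} → SOF ar → ℕ
varsᶠ (t ≐ u) = varsᵗ t ⊔ varsᵗ u
varsᶠ (t ≺ u) = varsᵗ t ⊔ varsᵗ u
varsᶠ falsum = 0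
varsᶠ (rel j ts) = varsᵛ ts
varsᶠ (¬ᶠ φ) = varsᶠ φ
varsᶠ (φ ∧ᶠ ψ) = varsᶠ φ ⊔ varsᶠ ψ
varsᶠ (φ ∨ᶠ ψ) = varsᶠ φ ⊔ varsᶠ ψ
varsᶠ (∃ᶠ x φ) = suc x ⊔ varsᶠ φ
varsᶠ (∀ᶠ x φ) = suc x ⊔ varsᶠ φ

⊔≤ˡ : ∀ {m n o} → m ⊔ n ≤ o → m ≤ o
⊔≤ˡ {m} {n} = m⊔n≤o⇒m≤o m n

⊔≤ʳ : ∀ {m n o} → m ⊔ n ≤ o → n ≤ o
⊔≤ʳ {m} {n} = m⊔n≤o⇒n≤o m n

module _ {P : ℕ → Set} where

  TermIn-vars : ∀ t → (∀ {y} → y < varsᵗ t → P y) → TermIn P t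
  TermIn-vars (var x) p = p (n<1+n x)
  TermIn-vars 𝟘 p = tt
  TermIn-vars 𝟙 p = tt
  TermIn-vars (t ⊕ u) p = TermIn-vars t (p ∘ m<n⇒m<n⊔o _) , TermIn-vars u (p ∘ m<n⇒m<o⊔n _)
  TermIn-vars (t ⊗ u) p = TermIn-vars t (p ∘ m<n⇒m<n⊔o _) , TermIn-vars u (p ∘ m<n⇒m<o⊔n _)

  VecIn-vars : ∀ {n} (ts : Vec Term n) → (∀ {y} → y < varsᵛ ts → P y) →
               Vec.foldr (λ _ → Set) (λ t A → TermIn P t × A) ⊤ ts
  VecIn-vars [] p = tt
  VecIn-vars (t ∷ ts) p = TermIn-vars t (p ∘ m<n⇒m<n⊔o _) , VecIn-vars ts (p ∘ m<n⇒m<o⊔n _)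

SCLFreeIn-vars : ∀ {P} φ → (∀ {y} → y < varsˢ φ → P y) → SCLFreeIn P φ
SCLFreeIn-vars (t ≐ u) p = TermIn-vars t (p ∘ m<n⇒m<n⊔o _) , TermIn-vars u (p ∘ m<n⇒m<o⊔n _)
SCLFreeIn-vars (t ≺ u) p = TermIn-vars t (p ∘ m<n⇒m<n⊔o _) , TermIn-vars u (p ∘ m<n⇒m<o⊔n _)
SCLFreeIn-vars falsum p = tt
SCLFreeIn-vars (¬ˢ φ) p = SCLFreeIn-vars φ p
SCLFreeIn-vars (φ ∧ˢ ψ) p = SCLFreeIn-vars φ (p ∘ m<n⇒m<n⊔o _) , SCLFreeIn-vars ψ (p ∘ m<n⇒m<o⊔n _)
SCLFreeIn-vars (φ ∨ˢ ψ) p = SCLFreeIn-vars φ (p ∘ m<n⇒m<n⊔o _) , SCLFreeIn-vars ψ (p ∘ m<n⇒m<o⊔n _)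
SCLFreeIn-vars (∃ˢ x φ) p = SCLFreeIn-vars φ (inj₂ ∘ p ∘ m<n⇒m<o⊔n (suc x))
SCLFreeIn-vars (∀ˢ x φ) p = SCLFreeIn-vars φ (inj₂ ∘ p ∘ m<n⇒m<o⊔n (suc x))
SCLFreeIn-vars (claim L) p = tt
SCLFreeIn-vars (lab L φ) p = SCLFreeIn-vars φ p

SOFFreeIn-vars : ∀ {ar P} (φ : SOF ar) → (∀ {y} → y < varsᶠ φ → P y) → SOFFreeIn P φ
SOFFreeIn-vars (t ≐ u) p = TermIn-vars t (p ∘ m<n⇒m<n⊔o _) , TermIn-vars u (p ∘ m<n⇒m<o⊔n _)
SOFFreeIn-vars (t ≺ u) p = TermIn-vars t (p ∘ m<n⇒m<n⊔o _) , TermIn-vars u (p ∘ m<n⇒m<o⊔n _)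
SOFFreeIn-vars falsum p = tt
SOFFreeIn-vars (rel j ts) p = VecIn-vars ts p
SOFFreeIn-vars (¬ᶠ φ) p = SOFFreeIn-vars φ p
SOFFreeIn-vars (φ ∧ᶠ ψ) p = SOFFreeIn-vars φ (p ∘ m<n⇒m<n⊔o _) , SOFFreeIn-vars ψ (p ∘ m<n⇒m<o⊔n _)
SOFFreeIn-vars (φ ∨ᶠ ψ) p = SOFFreeIn-vars φ (p ∘ m<n⇒m<n⊔o _) , SOFFreeIn-vars ψ (p ∘ m<n⇒m<o⊔n _)
SOFFreeIn-vars (∃ᶠ x φ) p = SOFFreeIn-vars φ (inj₂ ∘ p ∘ m<n⇒m<o⊔n (suc x))
SOFFreeIn-vars (∀ᶠ x φ) p = SOFFreeIn-vars φ (inj₂ ∘ p ∘ m<n⇒m<o⊔n (suc x))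

module _ {N : ℕ} where

  ⟦⟧-cong : ∀ {r r′} t → varsᵗ t ≤ N → Agree N r r′ → ⟦ t ⟧ r ≡ ⟦ t ⟧ r′
  ⟦⟧-cong (var x) b ag = ag b
  ⟦⟧-cong 𝟘 b ag = refl
  ⟦⟧-cong 𝟙 b ag = refl
  ⟦⟧-cong (t ⊕ u) b ag = cong₂ _+_ (⟦⟧-cong t (⊔≤ˡ b) ag) (⟦⟧-cong u (⊔≤ʳ {varsᵗ t} b) ag)
  ⟦⟧-cong (t ⊗ u) b ag = cong₂ _*_ (⟦⟧-cong t (⊔≤ˡ b) ag) (⟦⟧-cong u (⊔≤ʳ {varsᵗ t} b) ag)

  ⟦⟧ᵛ-cong : ∀ {n r r′} (ts : Vec Term n) → varsᵛ ts ≤ N → Agree N r r′ →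
             Vec.map (λ t → ⟦ t ⟧ r) ts ≡ Vec.map (λ t → ⟦ t ⟧ r′) ts
  ⟦⟧ᵛ-cong [] b ag = refl
  ⟦⟧ᵛ-cong (t ∷ ts) b ag =
    cong₂ _∷_ (⟦⟧-cong t (⊔≤ˡ b) ag) (⟦⟧ᵛ-cong ts (⊔≤ʳ {varsᵗ t} b) ag)

  Sat-cong : ∀ {ar} (R : RelAsg ar) {r r′} (φ : SOF ar) → varsᶠ φ ≤ N → Agree N r r′ →
             Sat R r φ → Sat R r′ φ
  Sat-cong R (t ≐ u) b ag =
    subst₂ _≡_ (⟦⟧-cong t (⊔≤ˡ b) ag) (⟦⟧-cong u (⊔≤ʳ {varsᵗ t} b) ag)
  Sat-cong R (t ≺ u) b ag =
    subst₂ _<_ (⟦⟧-cong t (⊔≤ˡ b) ag) (⟦⟧-cong u (⊔≤ʳ {varsᵗ t} b) ag)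
  Sat-cong R falsum b ag = id
  Sat-cong R (rel j ts) b ag = subst (T ∘ R j) (⟦⟧ᵛ-cong ts b ag)
  Sat-cong R (¬ᶠ φ) b ag = _∘ Sat-cong R φ b (Agree-sym ag)
  Sat-cong R (φ ∧ᶠ ψ) b ag (p , q) = Sat-cong R φ (⊔≤ˡ b) ag p , Sat-cong R ψ (⊔≤ʳ {varsᶠ φ} b) ag q
  Sat-cong R (φ ∨ᶠ ψ) b ag (inj₁ p) = inj₁ (Sat-cong R φ (⊔≤ˡ b) ag p)
  Sat-cong R (φ ∨ᶠ ψ) b ag (inj₂ q) = inj₂ (Sat-cong R ψ (⊔≤ʳ {varsᶠ φ} b) ag q)
  Sat-cong R (∃ᶠ x φ) b ag (a , p) =
    a , Sat-cong R φ (⊔≤ʳ {suc x} b) (Agree-update a x ag) p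
  Sat-cong R (∀ᶠ x φ) b ag p a =
    Sat-cong R φ (⊔≤ʳ {suc x} b) (Agree-update a x ag) (p a)

-- Congruence of the game is a bisimulation argument, which spares a case
-- distinction on signs.

varsᵉ≤ : ℕ → Env → Set
varsᵉ≤ N ε = ⊤
varsᵉ≤ N (bind L φ e rest) = varsˢ φ ≤ N × varsᵉ≤ N e × varsᵉ≤ N rest

refOf-vars : ∀ {N} L e {φ e′} → varsᵉ≤ N e → refOf L e ≡ just (φ , e′) →
             varsˢ φ ≤ N × varsᵉ≤ N e′
refOf-vars L (bind L′ φ e rest) (b , be , br) eq with L ≡ᵇ L′
refOf-vars L (bind L′ φ e rest) (b , be , br) refl | true = b , be
... | false = refOf-vars L rest br eq

module _ (N : ℕ) where

  data _≈ᵖ_ : Position → Position → Set where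
    pos≈ : ∀ {φ e r r′ s} → varsˢ φ ≤ N → varsᵉ≤ N e → Agree N r r′ →
           ⟨ φ , e , r , s ⟩ ≈ᵖ ⟨ φ , e , r′ , s ⟩

  data _≈ˢ_ : Step → Step → Set where
    refl≈  : ∀ {s} → s ≈ˢ s
    auto≈  : ∀ {p p′} → p ≈ᵖ p′ → auto p ≈ˢ auto p′
    pick₂≈ : ∀ {o p p′ q q′} → p ≈ᵖ p′ → q ≈ᵖ q′ → pick₂ o p q ≈ˢ pick₂ o p′ q′
    pickℕ≈ : ∀ {o f f′} → (∀ n → f n ≈ᵖ f′ n) → pickℕ o f ≈ˢ pickℕ o f′

  atom≈ : ∀ {b b′} s → b ≡ b′ → atomStep b s ≈ˢ atomStep b′ s
  atom≈ s refl = refl≈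

  step-cong : ∀ {p p′} → p ≈ᵖ p′ → step p ≈ˢ step p′
  step-cong {⟨ t ≐ u , e , r , s ⟩} (pos≈ b be ag) =
    atom≈ s (cong₂ _≡ᵇ_ (⟦⟧-cong t (⊔≤ˡ b) ag) (⟦⟧-cong u (⊔≤ʳ {varsᵗ t} b) ag))
  step-cong {⟨ t ≺ u , e , r , s ⟩} (pos≈ b be ag) =
    atom≈ s (cong₂ _<ᵇ_ (⟦⟧-cong t (⊔≤ˡ b) ag) (⟦⟧-cong u (⊔≤ʳ {varsᵗ t} b) ag))
  step-cong {⟨ falsum , e , r , s ⟩} (pos≈ b be ag) = refl≈
  step-cong {⟨ ¬ˢ φ , e , r , s ⟩} (pos≈ b be ag) = auto≈ (pos≈ b be ag)
  step-cong {⟨ φ ∧ˢ ψ , e , r , s ⟩} (pos≈ b be ag) =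
    pick₂≈ (pos≈ (⊔≤ˡ b) be ag) (pos≈ (⊔≤ʳ {varsˢ φ} b) be ag)
  step-cong {⟨ φ ∨ˢ ψ , e , r , s ⟩} (pos≈ b be ag) =
    pick₂≈ (pos≈ (⊔≤ˡ b) be ag) (pos≈ (⊔≤ʳ {varsˢ φ} b) be ag)
  step-cong {⟨ ∃ˢ x φ , e , r , s ⟩} (pos≈ b be ag) =
    pickℕ≈ λ n → pos≈ (⊔≤ʳ {suc x} b) be (Agree-update n x ag)
  step-cong {⟨ ∀ˢ x φ , e , r , s ⟩} (pos≈ b be ag) =
    pickℕ≈ λ n → pos≈ (⊔≤ʳ {suc x} b) be (Agree-update n x ag)
  step-cong {⟨ claim L , e , r , s ⟩} (pos≈ b be ag) with refOf L e in eq
  ... | just (ψ , e′) = auto≈ (pos≈ (proj₁ (refOf-vars L e be eq)) (proj₂ (refOf-vars L e be eq)) ag)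
  ... | nothing = refl≈
  step-cong {⟨ lab L φ , e , r , s ⟩} (pos≈ b be ag) = auto≈ (pos≈ b (b , be , be) ag)

  Win-resp : ∀ {s s′} → s ≈ˢ s′ → Win s → Win s′
  Win-resp refl≈ w = w
  Win-resp (auto≈ e) (move w) = move (Win-resp (step-cong e) w)
  Win-resp (pick₂≈ e e′) (left w) = left (Win-resp (step-cong e) w)
  Win-resp (pick₂≈ e e′) (right w) = right (Win-resp (step-cong e′) w)
  Win-resp (pick₂≈ e e′) (both w w′) = both (Win-resp (step-cong e) w) (Win-resp (step-cong e′) w′)
  Win-resp (pickℕ≈ e) (some n w) = some n (Win-resp (step-cong (e n)) w)
  Win-resp (pickℕ≈ e) (every w) = every λ n → Win-resp (step-cong (e n)) (w n)

  Win-cong : ∀ φ e s {r r′} → varsˢ φ ≤ N → varsᵉ≤ N e → Agree N r r′ →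
             Win (step ⟨ φ , e , r , s ⟩) → Win (step ⟨ φ , e , r′ , s ⟩)
  Win-cong φ e s {r} b be ag = Win-resp (step-cong {⟨ φ , e , r , s ⟩} (pos≈ b be ag))

-- Coding

-- An injective pairing that is a polynomial, hence a term of the language.
-- Abstract, lest normalisation expand codes into huge polynomials.
abstract
  pair : ℕ → ℕ → ℕ
  pair a b = (a + b) * (a + b) + a

  -- `pair a b` is at least the square of `a + b` and below the next square, so the sum of the
  -- components decides the order.
  pair-< : ∀ a b c d → a + b < c + d → pair a b < pair c d
  pair-< a b c d lt = begin-strict
    (a + b) * (a + b) + a            ≤⟨ +-monoʳ-≤ ((a + b) * (a + b)) (m≤m+n a b) ⟩
    (a + b) * (a + b) + (a + b)      ≡⟨ +-comm ((a + b) * (a + b)) (a + b) ⟩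
    suc (a + b) * (a + b)            <⟨ *-monoʳ-< (suc (a + b)) (n<1+n (a + b)) ⟩
    suc (a + b) * suc (a + b)        ≤⟨ *-mono-≤ lt lt ⟩
    (c + d) * (c + d)                ≤⟨ m≤m+n _ c ⟩
    (c + d) * (c + d) + c            ∎
    where open ≤-Reasoning

  pair-injective : ∀ {a b c d} → pair a b ≡ pair c d → a ≡ c × b ≡ d
  pair-injective {a} {b} {c} {d} eq with <-cmp (a + b) (c + d)
  ... | tri< lt _ _ = ⊥-elim (<⇒≢ (pair-< a b c d lt) eq)
  ... | tri> _ _ gt = ⊥-elim (<⇒≢ (pair-< c d a b gt) (sym eq))
  ... | tri≈ _ s≡ _ = a≡c , +-cancelˡ-≡ c b d (trans (cong (_+ b) (sym a≡c)) s≡)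
    where
    a≡c : a ≡ c
    a≡c = +-cancelˡ-≡ ((c + d) * (c + d)) a c (trans (cong (λ n → n * n + a) (sym s≡)) eq)

pairᵗ : Term → Term → Term
pairᵗ t u = ((t ⊕ u) ⊗ (t ⊕ u)) ⊕ t

abstract
  ⟦pairᵗ⟧ : ∀ t u r → ⟦ pairᵗ t u ⟧ r ≡ pair (⟦ t ⟧ r) (⟦ u ⟧ r)
  ⟦pairᵗ⟧ t u r = refl

numeral : ℕ → Term
numeral zero = 𝟘
numeral (suc n) = 𝟙 ⊕ numeral n

⟦numeral⟧ : ∀ n {r} → ⟦ numeral n ⟧ r ≡ n
⟦numeral⟧ zero = refl
⟦numeral⟧ (suc n) = cong suc (⟦numeral⟧ n)

vars-numeral : ∀ n → varsᵗ (numeral n) ≡ 0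
vars-numeral zero = refl
vars-numeral (suc n) = vars-numeral n

codeAsg : ℕ → Assignment → ℕ
codeAsg zero r = 0
codeAsg (suc n) r = pair (r n) (codeAsg n r)

codeAsg-injective : ∀ N {r r′} → codeAsg N r ≡ codeAsg N r′ → Agree N r r′
codeAsg-injective (suc N) eq {i} i<1+N with pair-injective eq | m≤n⇒m<n∨m≡n i<1+N
... | _ , eqs | inj₁ (s≤s i<N) = codeAsg-injective N eqs i<N
... | eq₀ , _ | inj₂ refl = eq₀

codeAsg-cong : ∀ N {r r′} → Agree N r r′ → codeAsg N r ≡ codeAsg N r′
codeAsg-cong zero ag = refl
codeAsg-cong (suc N) ag = cong₂ pair (ag (n<1+n N)) (codeAsg-cong N (ag ∘ m<n⇒m<1+n))

-- The renaming `f` is `id` for the translation into second-order logic and `8 +_` for the game,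
-- where the variables of the formula are shifted.
asgᵗ : (ℕ → ℕ) → ℕ → Term
asgᵗ f zero = 𝟘
asgᵗ f (suc n) = pairᵗ (var (f n)) (asgᵗ f n)

⟦asgᵗ⟧ : ∀ f n r → ⟦ asgᵗ f n ⟧ r ≡ codeAsg n (r ∘ f)
⟦asgᵗ⟧ f zero r = refl
⟦asgᵗ⟧ f (suc n) r =
  trans (⟦pairᵗ⟧ (var (f n)) (asgᵗ f n) r) (cong (pair (r (f n))) (⟦asgᵗ⟧ f n r))

-- Injective only at a fixed length: `[]` and `0 ∷ []` share the code 0. The arity is always known
-- from the relation symbol.
codeVec : ∀ {n} → Vec ℕ n → ℕ
codeVec [] = 0
codeVec (a ∷ v) = pair a (codeVec v)

codeVec-injective : ∀ {n} {v v′ : Vec ℕ n} → codeVec v ≡ codeVec v′ → v ≡ v′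
codeVec-injective {v = []} {[]} eq = refl
codeVec-injective {v = a ∷ v} {a′ ∷ v′} eq with pair-injective eq
... | refl , eqs = cong (a ∷_) (codeVec-injective eqs)

-- Syntax is coded through binary trees, where injectivity is witnessed by a
-- left inverse with junk values outside the range.

data Code : Set where
  leaf : ℕ → Code
  fork : Code → Code → Code

code : Code → ℕ
code (leaf n) = pair 0 n
code (fork c d) = pair 1 (pair (code c) (code d))

code-injective : ∀ c d → code c ≡ code d → c ≡ d
code-injective (leaf m) (leaf n) eq = cong leaf (proj₂ (pair-injective eq))
code-injective (leaf m) (fork d d′) eq with () ← proj₁ (pair-injective eq)
code-injective (fork c c′) (leaf n) eq with () ← proj₁ (pair-injective eq)
code-injective (fork c c′) (fork d d′) eq with pair-injective (proj₂ (pair-injective eq))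
... | eq₁ , eq₂ = cong₂ fork (code-injective c d eq₁) (code-injective c′ d′ eq₂)

encᵗ : Term → Code
encᵗ (var x) = leaf (suc (suc x))
encᵗ 𝟘 = leaf 0
encᵗ 𝟙 = leaf 1
encᵗ (t ⊕ u) = fork (leaf 0) (fork (encᵗ t) (encᵗ u))
encᵗ (t ⊗ u) = fork (leaf 1) (fork (encᵗ t) (encᵗ u))

decᵗ : Code → Term
decᵗ (leaf 1) = 𝟙
decᵗ (leaf (suc (suc x))) = var x
decᵗ (fork (leaf 0) (fork c d)) = decᵗ c ⊕ decᵗ d
decᵗ (fork (leaf 1) (fork c d)) = decᵗ c ⊗ decᵗ d
decᵗ _ = 𝟘

dec-encᵗ : ∀ t → decᵗ (encᵗ t) ≡ t
dec-encᵗ (var x) = refl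
dec-encᵗ 𝟘 = refl
dec-encᵗ 𝟙 = refl
dec-encᵗ (t ⊕ u) = cong₂ _⊕_ (dec-encᵗ t) (dec-encᵗ u)
dec-encᵗ (t ⊗ u) = cong₂ _⊗_ (dec-encᵗ t) (dec-encᵗ u)

encᵛ : ∀ {n} → Vec Term n → Code
encᵛ [] = leaf 0
encᵛ (t ∷ ts) = fork (encᵗ t) (encᵛ ts)

decᵛ : ∀ n → Code → Vec Term n
decᵛ zero _ = []
decᵛ (suc n) (fork c d) = decᵗ c ∷ decᵛ n d
decᵛ (suc n) (leaf m) = 𝟘 ∷ decᵛ n (leaf m)

dec-encᵛ : ∀ {n} (ts : Vec Term n) → decᵛ n (encᵛ ts) ≡ ts
dec-encᵛ [] = refl
dec-encᵛ (t ∷ ts) = cong₂ _∷_ (dec-encᵗ t) (dec-encᵛ ts)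

module _ {ar : List ℕ} where

  encᶠ : SOF ar → Code
  encᶠ (t ≐ u) = fork (leaf 0) (fork (encᵗ t) (encᵗ u))
  encᶠ (t ≺ u) = fork (leaf 1) (fork (encᵗ t) (encᵗ u))
  encᶠ falsum = leaf 0
  encᶠ (rel j ts) = fork (leaf 2) (fork (leaf (toℕ j)) (encᵛ ts))
  encᶠ (¬ᶠ φ) = fork (leaf 3) (encᶠ φ)
  encᶠ (φ ∧ᶠ ψ) = fork (leaf 4) (fork (encᶠ φ) (encᶠ ψ))
  encᶠ (φ ∨ᶠ ψ) = fork (leaf 5) (fork (encᶠ φ) (encᶠ ψ))
  encᶠ (∃ᶠ x φ) = fork (leaf 6) (fork (leaf x) (encᶠ φ))
  encᶠ (∀ᶠ x φ) = fork (leaf 7) (fork (leaf x) (encᶠ φ))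

  -- The arity depends on the index, so the index must first be known to be in range; that decision
  -- is an argument so that `decRel-enc` can split on it.
  decRel : (j : ℕ) → Dec (j < length ar) → Code → SOF ar
  decRel j (yes j<n) c = rel (fromℕ< j<n) (decᵛ _ c)
  decRel j (no _) c = falsum

  decᶠ : Code → SOF ar
  decᶠ (fork (leaf 0) (fork c d)) = decᵗ c ≐ decᵗ d
  decᶠ (fork (leaf 1) (fork c d)) = decᵗ c ≺ decᵗ d
  decᶠ (fork (leaf 2) (fork (leaf j) c)) = decRel j (j <? length ar) c
  decᶠ (fork (leaf 3) c) = ¬ᶠ decᶠ c
  decᶠ (fork (leaf 4) (fork c d)) = decᶠ c ∧ᶠ decᶠ d
  decᶠ (fork (leaf 5) (fork c d)) = decᶠ c ∨ᶠ decᶠ d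
  decᶠ (fork (leaf 6) (fork (leaf x) c)) = ∃ᶠ x (decᶠ c)
  decᶠ (fork (leaf 7) (fork (leaf x) c)) = ∀ᶠ x (decᶠ c)
  decᶠ _ = falsum

  decRel-enc : ∀ j ts d → decRel (toℕ j) d (encᵛ ts) ≡ rel j ts
  decRel-enc j ts (no ¬j<n) = ⊥-elim (¬j<n (toℕ<n j))
  decRel-enc j ts (yes j<n) rewrite fromℕ<-toℕ j j<n | dec-encᵛ ts = refl

  dec-encᶠ : ∀ φ → decᶠ (encᶠ φ) ≡ φ
  dec-encᶠ (t ≐ u) = cong₂ _≐_ (dec-encᵗ t) (dec-encᵗ u)
  dec-encᶠ (t ≺ u) = cong₂ _≺_ (dec-encᵗ t) (dec-encᵗ u)
  dec-encᶠ falsum = refl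
  dec-encᶠ (rel j ts) = decRel-enc j ts (toℕ j <? length ar)
  dec-encᶠ (¬ᶠ φ) = cong ¬ᶠ_ (dec-encᶠ φ)
  dec-encᶠ (φ ∧ᶠ ψ) = cong₂ _∧ᶠ_ (dec-encᶠ φ) (dec-encᶠ ψ)
  dec-encᶠ (φ ∨ᶠ ψ) = cong₂ _∨ᶠ_ (dec-encᶠ φ) (dec-encᶠ ψ)
  dec-encᶠ (∃ᶠ x φ) = cong (∃ᶠ x) (dec-encᶠ φ)
  dec-encᶠ (∀ᶠ x φ) = cong (∀ᶠ x) (dec-encᶠ φ)

encˢ : SCL → Code
encˢ (t ≐ u) = fork (leaf 0) (fork (encᵗ t) (encᵗ u))
encˢ (t ≺ u) = fork (leaf 1) (fork (encᵗ t) (encᵗ u))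
encˢ falsum = leaf 0
encˢ (claim L) = leaf (suc L)
encˢ (lab L φ) = fork (leaf 2) (fork (leaf L) (encˢ φ))
encˢ (¬ˢ φ) = fork (leaf 3) (encˢ φ)
encˢ (φ ∧ˢ ψ) = fork (leaf 4) (fork (encˢ φ) (encˢ ψ))
encˢ (φ ∨ˢ ψ) = fork (leaf 5) (fork (encˢ φ) (encˢ ψ))
encˢ (∃ˢ x φ) = fork (leaf 6) (fork (leaf x) (encˢ φ))
encˢ (∀ˢ x φ) = fork (leaf 7) (fork (leaf x) (encˢ φ))

decˢ : Code → SCL
decˢ (leaf (suc L)) = claim L
decˢ (fork (leaf 0) (fork c d)) = decᵗ c ≐ decᵗ d
decˢ (fork (leaf 1) (fork c d)) = decᵗ c ≺ decᵗ d
decˢ (fork (leaf 2) (fork (leaf L) c)) = lab L (decˢ c)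
decˢ (fork (leaf 3) c) = ¬ˢ decˢ c
decˢ (fork (leaf 4) (fork c d)) = decˢ c ∧ˢ decˢ d
decˢ (fork (leaf 5) (fork c d)) = decˢ c ∨ˢ decˢ d
decˢ (fork (leaf 6) (fork (leaf x) c)) = ∃ˢ x (decˢ c)
decˢ (fork (leaf 7) (fork (leaf x) c)) = ∀ˢ x (decˢ c)
decˢ _ = falsum

dec-encˢ : ∀ φ → decˢ (encˢ φ) ≡ φ
dec-encˢ (t ≐ u) = cong₂ _≐_ (dec-encᵗ t) (dec-encᵗ u)
dec-encˢ (t ≺ u) = cong₂ _≺_ (dec-encᵗ t) (dec-encᵗ u)
dec-encˢ falsum = refl
dec-encˢ (claim L) = refl
dec-encˢ (lab L φ) = cong (lab L) (dec-encˢ φ)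
dec-encˢ (¬ˢ φ) = cong ¬ˢ_ (dec-encˢ φ)
dec-encˢ (φ ∧ˢ ψ) = cong₂ _∧ˢ_ (dec-encˢ φ) (dec-encˢ ψ)
dec-encˢ (φ ∨ˢ ψ) = cong₂ _∨ˢ_ (dec-encˢ φ) (dec-encˢ ψ)
dec-encˢ (∃ˢ x φ) = cong (∃ˢ x) (dec-encˢ φ)
dec-encˢ (∀ˢ x φ) = cong (∀ˢ x) (dec-encˢ φ)

encᵉ : Env → Code
encᵉ ε = leaf 0
encᵉ (bind L φ e rest) = fork (fork (leaf L) (encˢ φ)) (fork (encᵉ e) (encᵉ rest))

decᵉ : Code → Env
decᵉ (fork (fork (leaf L) c) (fork d d′)) = bind L (decˢ c) (decᵉ d) (decᵉ d′)
decᵉ _ = ε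

dec-encᵉ : ∀ e → decᵉ (encᵉ e) ≡ e
dec-encᵉ ε = refl
dec-encᵉ (bind L φ e rest)
  rewrite dec-encˢ φ | dec-encᵉ e | dec-encᵉ rest = refl

fork-injective : ∀ {c d c′ d′} → fork c d ≡ fork c′ d′ → c ≡ c′ × d ≡ d′
fork-injective refl = refl , refl

leaf-injective : ∀ {m n} → leaf m ≡ leaf n → m ≡ n
leaf-injective refl = refl

bit : Sign → ℕ
bit pos = 0
bit neg = 1

bit-injective : ∀ s s′ → bit s ≡ bit s′ → s ≡ s′
bit-injective pos pos _ = refl
bit-injective neg neg _ = refl

nodeCode : SCL → Env → Sign → ℕ
nodeCode φ e s = code (fork (leaf (bit s)) (fork (encˢ φ) (encᵉ e)))

nodeCode-injective : ∀ {φ e s φ′ e′ s′} → nodeCode φ e s ≡ nodeCode φ′ e′ s′ →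
                     φ ≡ φ′ × e ≡ e′ × s ≡ s′
nodeCode-injective {φ} {e} {s} {φ′} {e′} {s′} eq
  with fork-injective (code-injective (fork (leaf (bit s)) (fork (encˢ φ) (encᵉ e)))
                                      (fork (leaf (bit s′)) (fork (encˢ φ′) (encᵉ e′))) eq)
... | eq₁ , eq₂ with fork-injective eq₂
...   | eq₃ , eq₄ =
  trans (sym (dec-encˢ φ)) (trans (cong decˢ eq₃) (dec-encˢ φ′)) ,
  trans (sym (dec-encᵉ e)) (trans (cong decᵉ eq₄) (dec-encᵉ e′)) ,
  bit-injective s s′ (leaf-injective eq₁)

quantCode : ∀ {ar} → Sign → ℕ → SOF ar → ℕ
quantCode s x φ = code (fork (leaf (bit s)) (fork (leaf x) (encᶠ φ)))

quantCode-injective : ∀ {ar s x s′ x′} {φ φ′ : SOF ar} →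
                      quantCode s x φ ≡ quantCode s′ x′ φ′ → s ≡ s′ × x ≡ x′ × φ ≡ φ′
quantCode-injective {s = s} {x} {s′} {x′} {φ} {φ′} eq
  with fork-injective (code-injective (fork (leaf (bit s)) (fork (leaf x) (encᶠ φ)))
                                      (fork (leaf (bit s′)) (fork (leaf x′) (encᶠ φ′))) eq)
... | eq₁ , eq₂ with fork-injective eq₂
...   | eq₃ , eq₄ =
  bit-injective s s′ (leaf-injective eq₁) ,
  leaf-injective eq₃ ,
  trans (sym (dec-encᶠ φ)) (trans (cong decᶠ eq₄) (dec-encᶠ φ′))

-- Signs and winning at atomic formulas.

Signed : Sign → Set → Set
Signed pos A = A
Signed neg A = ¬ A

Win-atom⁻ : ∀ {A : Set} b s → (T b → A) → (A → T b) → Win (atomStep b s) → Signed s A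
Win-atom⁻ true pos f g w = f tt
Win-atom⁻ false neg f g w = g

Win-atom : ∀ {A : Set} b s → (T b → A) → (A → T b) → Signed s A → Win (atomStep b s)
Win-atom true pos f g a = won
Win-atom false pos f g a = ⊥-elim (g a)
Win-atom true neg f g ¬a = ⊥-elim (¬a (f tt))
Win-atom false neg f g ¬a = won

module _ (t u : Term) (e : Env) (r : Assignment) (s : Sign) where

  Win-≐⁻ : Win (step ⟨ t ≐ u , e , r , s ⟩) → Signed s (⟦ t ⟧ r ≡ ⟦ u ⟧ r)
  Win-≐⁻ = Win-atom⁻ (⟦ t ⟧ r ≡ᵇ ⟦ u ⟧ r) s (≡ᵇ⇒≡ _ _) (≡⇒≡ᵇ _ _)

  Win-≐ : Signed s (⟦ t ⟧ r ≡ ⟦ u ⟧ r) → Win (step ⟨ t ≐ u , e , r , s ⟩)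
  Win-≐ = Win-atom (⟦ t ⟧ r ≡ᵇ ⟦ u ⟧ r) s (≡ᵇ⇒≡ _ _) (≡⇒≡ᵇ _ _)

  Win-≺⁻ : Win (step ⟨ t ≺ u , e , r , s ⟩) → Signed s (⟦ t ⟧ r < ⟦ u ⟧ r)
  Win-≺⁻ = Win-atom⁻ (⟦ t ⟧ r <ᵇ ⟦ u ⟧ r) s (<ᵇ⇒< _ _) <⇒<ᵇ

  Win-≺ : Signed s (⟦ t ⟧ r < ⟦ u ⟧ r) → Win (step ⟨ t ≺ u , e , r , s ⟩)
  Win-≺ = Win-atom (⟦ t ⟧ r <ᵇ ⟦ u ⟧ r) s (<ᵇ⇒< _ _) <⇒<ᵇ

-- A variable that is not among x₁, …, x_k may be used freely inside a defining
-- formula after setting it to 0, its value under tupleAsg.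

zeros : ℕ → ℕ → Assignment → Assignment
zeros k zero r = r
zeros k (suc n) r = zeros (suc k) n (r [ 0 / k ])

zeros-id : ∀ k n r → (∀ {i} → k ≤ i → r i ≡ 0) → ∀ i → zeros k n r i ≡ r i
zeros-id k zero r z i = refl
zeros-id k (suc n) r z i = trans (zeros-id (suc k) n (r [ 0 / k ]) z′ i) (at-k i)
  where
  at-k : ∀ i → (r [ 0 / k ]) i ≡ r i
  at-k i with i ≟ k
  ... | yes refl = trans (update-same r 0 i) (sym (z ≤-refl))
  ... | no i≢k = update-other r 0 i≢k
  z′ : ∀ {i} → suc k ≤ i → (r [ 0 / k ]) i ≡ 0
  z′ {i} k<i = trans (at-k i) (z (<⇒≤ k<i))

tupleAsg-zero : ∀ {k} (m : Vec ℕ k) {i} → k ≤ i → tupleAsg m i ≡ 0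
tupleAsg-zero [] _ = refl
tupleAsg-zero (a ∷ m) {suc i} (s≤s k≤i) = tupleAsg-zero m k≤i

zeroedˢ : ℕ → ℕ → SCL → SCL
zeroedˢ k zero φ = φ
zeroedˢ k (suc n) φ = ∃ˢ k ((var k ≐ 𝟘) ∧ˢ zeroedˢ (suc k) n φ)

zeroedᶠ : ∀ {ar} → ℕ → ℕ → SOF ar → SOF ar
zeroedᶠ k zero φ = φ
zeroedᶠ k (suc n) φ = ∃ᶠ k ((var k ≐ 𝟘) ∧ᶠ zeroedᶠ (suc k) n φ)

bound-next : ∀ {P : ℕ → Set} {k} → (∀ {y} → y < k → P y) → ∀ {y} → y < suc k → y ≡ k ⊎ P y
bound-next p y<1+k with m≤n⇒m<n∨m≡n y<1+k
... | inj₁ (s≤s y<k) = inj₂ (p y<k)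
... | inj₂ refl = inj₁ refl

zeroedˢ-free : ∀ {P} k n φ → varsˢ φ ≤ k + n → (∀ {y} → y < k → P y) →
               SCLFreeIn P (zeroedˢ k n φ)
zeroedˢ-free k zero φ b p =
  SCLFreeIn-vars φ λ y< → p (<-≤-trans y< (subst (varsˢ φ ≤_) (+-identityʳ k) b))
zeroedˢ-free k (suc n) φ b p =
  (inj₁ refl , tt) , zeroedˢ-free (suc k) n φ (subst (varsˢ φ ≤_) (+-suc k n) b) (bound-next p)

zeroedᶠ-free : ∀ {ar P} k n (φ : SOF ar) → varsᶠ φ ≤ k + n → (∀ {y} → y < k → P y) →
               SOFFreeIn P (zeroedᶠ k n φ)
zeroedᶠ-free k zero φ b p =
  SOFFreeIn-vars φ λ y< → p (<-≤-trans y< (subst (varsᶠ φ ≤_) (+-identityʳ k) b))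
zeroedᶠ-free k (suc n) φ b p =
  (inj₁ refl , tt) , zeroedᶠ-free (suc k) n φ (subst (varsᶠ φ ≤_) (+-suc k n) b) (bound-next p)

-- x need not be fresh for t: only the value v of t after the update matters.
module _ (x : ℕ) (t : Term) (φ : SCL) (e : Env) (r : Assignment) (v : ℕ)
         (eval : ∀ a → ⟦ t ⟧ (r [ a / x ]) ≡ v) where

  Win-let : Win (step ⟨ φ , e , r [ v / x ] , pos ⟩) →
            Win (step ⟨ ∃ˢ x ((var x ≐ t) ∧ˢ φ) , e , r , pos ⟩)
  Win-let w = some v (both (Win-≐ (var x) t e (r [ v / x ]) pos
                                  (trans (update-same r v x) (sym (eval v)))) w)

  Win-let⁻ : Win (step ⟨ ∃ˢ x ((var x ≐ t) ∧ˢ φ) , e , r , pos ⟩) →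
             Win (step ⟨ φ , e , r [ v / x ] , pos ⟩)
  Win-let⁻ (some a (both w w′)) =
    subst (λ a → Win (step ⟨ φ , e , r [ a / x ] , pos ⟩)) a≡v w′
    where
    a≡v : a ≡ v
    a≡v = trans (sym (update-same r a x))
                (trans (Win-≐⁻ (var x) t e (r [ a / x ]) pos w) (eval a))

Win-zeroed : ∀ k n φ e r → Win (step ⟨ zeroedˢ k n φ , e , r , pos ⟩) ⇔
                           Win (step ⟨ φ , e , zeros k n r , pos ⟩)
Win-zeroed k zero φ e r = mk⇔ id id
Win-zeroed k (suc n) φ e r = mk⇔
  (to (Win-zeroed (suc k) n φ e _) ∘ Win-let⁻ k 𝟘 _ e r 0 (λ _ → refl))
  (Win-let k 𝟘 _ e r 0 (λ _ → refl) ∘ from (Win-zeroed (suc k) n φ e _))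

Sat-zeroed : ∀ {ar} (R : RelAsg ar) k n (φ : SOF ar) r →
             Sat R r (zeroedᶠ k n φ) ⇔ Sat R (zeros k n r) φ
Sat-zeroed R k zero φ r = mk⇔ id id
Sat-zeroed R k (suc n) φ r = mk⇔
  (λ { (a , a≡0 , p) → to (Sat-zeroed R (suc k) n φ _)
         (subst (λ a → Sat R (r [ a / k ]) (zeroedᶠ (suc k) n φ))
                (trans (sym (update-same r a k)) a≡0) p) })
  (λ p → 0 , update-same r 0 k , from (Sat-zeroed R (suc k) n φ _) p)

-- From SCL to Π¹₁

module FromSCL (N : ℕ) where

  Fm : Set
  Fm = SOF (1 ∷ [])

  key : SCL → Env → Sign → Assignment → ℕ
  key φ e s r = pair (nodeCode φ e s) (codeAsg N r)

  keyᵗ : SCL → Env → Sign → Term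
  keyᵗ φ e s = pairᵗ (numeral (nodeCode φ e s)) (asgᵗ id N)

  ⟦keyᵗ⟧ : ∀ φ e s r → ⟦ keyᵗ φ e s ⟧ r ≡ key φ e s r
  ⟦keyᵗ⟧ φ e s r = trans (⟦pairᵗ⟧ (numeral (nodeCode φ e s)) (asgᵗ id N) r)
    (cong₂ pair (⟦numeral⟧ (nodeCode φ e s)) (⟦asgᵗ⟧ id N r))

  member : SCL → Env → Sign → Fm
  member φ e s = rel zero (keyᵗ φ e s ∷ [])

  -- The first-order unfolding of the game, cut off at labels: there, and at claims, winning is
  -- replaced by membership in the relation variable. Hence the recursion is structural although
  -- plays may loop.
  tr : SCL → Env → Sign → Fm
  tr (t ≐ u) e pos = t ≐ u
  tr (t ≐ u) e neg = ¬ᶠ (t ≐ u)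
  tr (t ≺ u) e pos = t ≺ u
  tr (t ≺ u) e neg = ¬ᶠ (t ≺ u)
  tr falsum e pos = falsum
  tr falsum e neg = ¬ᶠ falsum
  tr (¬ˢ φ) e s = tr φ e (flip s)
  tr (φ ∧ˢ ψ) e pos = tr φ e pos ∧ᶠ tr ψ e pos
  tr (φ ∧ˢ ψ) e neg = tr φ e neg ∨ᶠ tr ψ e neg
  tr (φ ∨ˢ ψ) e pos = tr φ e pos ∨ᶠ tr ψ e pos
  tr (φ ∨ˢ ψ) e neg = tr φ e neg ∧ᶠ tr ψ e neg
  tr (∃ˢ x φ) e pos = ∃ᶠ x (tr φ e pos)
  tr (∃ˢ x φ) e neg = ∀ᶠ x (tr φ e neg)
  tr (∀ˢ x φ) e pos = ∀ᶠ x (tr φ e pos)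
  tr (∀ˢ x φ) e neg = ∃ᶠ x (tr φ e neg)
  tr (claim L) e s with refOf L e
  ... | just (ψ , e′) = member (lab L ψ) e′ s
  -- False under both signs, since nobody wins a stuck play.
  ... | nothing = falsum
  tr (lab L φ) e s = member (lab L φ) e s

  ∀ᶠ* : ℕ → Fm → Fm
  ∀ᶠ* zero φ = φ
  ∀ᶠ* (suc n) φ = ∀ᶠ* n (∀ᶠ n φ)

  premise⇒member : Label → SCL → Env → Sign → Fm
  premise⇒member L φ e s = (¬ᶠ tr φ (bind L φ e e) s) ∨ᶠ member (lab L φ) e s

  rule : Label → SCL → Env → Sign → Fm
  rule L φ e s = ∀ᶠ* N (premise⇒member L φ e s)

  -- Both signs are imposed at every label, because a loop through a negation can lead back to the
  -- same occurrence with the opposite sign.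
  closure : SCL → Env → Fm
  closure (t ≐ u) e = ¬ᶠ falsum
  closure (t ≺ u) e = ¬ᶠ falsum
  closure falsum e = ¬ᶠ falsum
  closure (¬ˢ φ) e = closure φ e
  closure (φ ∧ˢ ψ) e = closure φ e ∧ᶠ closure ψ e
  closure (φ ∨ˢ ψ) e = closure φ e ∧ᶠ closure ψ e
  closure (∃ˢ x φ) e = closure φ e
  closure (∀ˢ x φ) e = closure φ e
  closure (claim L) e = ¬ᶠ falsum
  closure (lab L φ) e = (rule L φ e pos ∧ᶠ rule L φ e neg) ∧ᶠ closure φ (bind L φ e e)

  Θ : SCL → Fm
  Θ φ = (¬ᶠ closure φ ε) ∨ᶠ tr φ ε pos

  vars-asgᵗ : ∀ n → varsᵗ (asgᵗ id n) ≤ n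
  vars-asgᵗ zero = z≤n
  vars-asgᵗ (suc n) = ⊔-lub (⊔-lub b b) ≤-refl
    where
    b : suc n ⊔ varsᵗ (asgᵗ id n) ≤ suc n
    b = ⊔-lub ≤-refl (m≤n⇒m≤1+n (vars-asgᵗ n))

  vars-member : ∀ φ e s → varsᶠ (member φ e s) ≤ N
  vars-member φ e s = ⊔-lub (⊔-lub (⊔-lub b b) n) z≤n
    where
    n : varsᵗ (numeral (nodeCode φ e s)) ≤ N
    n = ≤-trans (≤-reflexive (vars-numeral (nodeCode φ e s))) z≤n
    b : varsᵗ (numeral (nodeCode φ e s)) ⊔ varsᵗ (asgᵗ id N) ≤ N
    b = ⊔-lub n (vars-asgᵗ N)

  vars-tr : ∀ φ e s → varsˢ φ ≤ N → varsᶠ (tr φ e s) ≤ N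
  vars-tr (t ≐ u) e pos b = b
  vars-tr (t ≐ u) e neg b = b
  vars-tr (t ≺ u) e pos b = b
  vars-tr (t ≺ u) e neg b = b
  vars-tr falsum e pos b = b
  vars-tr falsum e neg b = b
  vars-tr (¬ˢ φ) e s b = vars-tr φ e (flip s) b
  vars-tr (φ ∧ˢ ψ) e pos b = ⊔-lub (vars-tr φ e pos (⊔≤ˡ b)) (vars-tr ψ e pos (⊔≤ʳ {varsˢ φ} b))
  vars-tr (φ ∧ˢ ψ) e neg b = ⊔-lub (vars-tr φ e neg (⊔≤ˡ b)) (vars-tr ψ e neg (⊔≤ʳ {varsˢ φ} b))
  vars-tr (φ ∨ˢ ψ) e pos b = ⊔-lub (vars-tr φ e pos (⊔≤ˡ b)) (vars-tr ψ e pos (⊔≤ʳ {varsˢ φ} b))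
  vars-tr (φ ∨ˢ ψ) e neg b = ⊔-lub (vars-tr φ e neg (⊔≤ˡ b)) (vars-tr ψ e neg (⊔≤ʳ {varsˢ φ} b))
  vars-tr (∃ˢ x φ) e pos b = ⊔-lub (⊔≤ˡ {suc x} {varsˢ φ} b) (vars-tr φ e pos (⊔≤ʳ {suc x} b))
  vars-tr (∃ˢ x φ) e neg b = ⊔-lub (⊔≤ˡ {suc x} {varsˢ φ} b) (vars-tr φ e neg (⊔≤ʳ {suc x} b))
  vars-tr (∀ˢ x φ) e pos b = ⊔-lub (⊔≤ˡ {suc x} {varsˢ φ} b) (vars-tr φ e pos (⊔≤ʳ {suc x} b))
  vars-tr (∀ˢ x φ) e neg b = ⊔-lub (⊔≤ˡ {suc x} {varsˢ φ} b) (vars-tr φ e neg (⊔≤ʳ {suc x} b))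
  vars-tr (claim L) e s b with refOf L e
  ... | just (ψ , e′) = vars-member (lab L ψ) e′ s
  ... | nothing = z≤n
  vars-tr (lab L φ) e s b = vars-member (lab L φ) e s

  ∀ᶠ*-intro : ∀ R n φ → (∀ r → Sat R r φ) → ∀ r → Sat R r (∀ᶠ* n φ)
  ∀ᶠ*-intro R zero φ p r = p r
  ∀ᶠ*-intro R (suc n) φ p r = ∀ᶠ*-intro R n (∀ᶠ n φ) (λ r a → p (r [ a / n ])) r

  -- From `n` upwards the resulting assignment keeps the values of `r`, so `r′` is matched only
  -- below `n`; congruence does the rest.
  ∀ᶠ*-elim : ∀ R n φ r → Sat R r (∀ᶠ* n φ) → ∀ r′ →
             Σ Assignment λ r″ → Agree n r′ r″ × Sat R r″ φ
  ∀ᶠ*-elim R zero φ r p r′ = r , (λ ()) , p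
  ∀ᶠ*-elim R (suc n) φ r p r′ with ∀ᶠ*-elim R n (∀ᶠ n φ) r p r′
  ... | r″ , ag , q = r″ [ r′ n / n ] , ag′ , q (r′ n)
    where
    ag′ : Agree (suc n) r′ (r″ [ r′ n / n ])
    ag′ {i} i<1+n with m≤n⇒m<n∨m≡n i<1+n
    ... | inj₁ (s≤s i<n) = trans (ag i<n) (sym (update-other r″ (r′ n) (<⇒≢ i<n)))
    ... | inj₂ refl = sym (update-same r″ (r′ n) n)

  module Sound (R : RelAsg (1 ∷ [])) (r₀ : Assignment) where

    Closed : SCL → Env → Set
    Closed φ e = varsˢ φ ≤ N × Sat R r₀ (closure φ e)

    -- A claim leads out of the current subformula, so the closure conditions of the enclosing
    -- labelled formulas travel with the environment.
    ClosedEnv : Env → Set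
    ClosedEnv ε = ⊤
    ClosedEnv (bind L φ e rest) = Closed (lab L φ) e × ClosedEnv e × ClosedEnv rest

    refOf-closed : ∀ L e {φ e′} → ClosedEnv e → refOf L e ≡ just (φ , e′) →
                   Closed (lab L φ) e′ × ClosedEnv e′
    refOf-closed L (bind L′ φ e rest) (c , ce , cr) eq with L ≡ᵇ L′ | ≡ᵇ⇒≡ L L′
    refOf-closed L (bind L′ φ e rest) (c , ce , cr) refl | true | L≡L′ with L≡L′ tt
    ... | refl = c , ce
    refOf-closed L (bind L′ φ e rest) (c , ce , cr) eq | false | _ = refOf-closed L rest cr eq

    apply-rule : ∀ L φ e s {r} → Closed (lab L φ) e → Sat R r (tr φ (bind L φ e e) s) →
                 Sat R r (member (lab L φ) e s)
    apply-rule L φ e s {r} (b , (c⁺ , c⁻) , _) p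
      with ∀ᶠ*-elim R N (premise⇒member L φ e s) r₀ (pick s) r
      where
      pick : ∀ s → Sat R r₀ (rule L φ e s)
      pick pos = c⁺
      pick neg = c⁻
    ... | r′ , ag , inj₁ ¬p = ⊥-elim (¬p (Sat-cong R (tr φ _ s) (vars-tr φ _ s b) ag p))
    ... | r′ , ag , inj₂ q =
      Sat-cong R (member (lab L φ) e s) (vars-member (lab L φ) e s) (Agree-sym ag) q

    -- Induction on the winning derivation, not on `φ`: a claim jumps to a larger formula but to a
    -- smaller derivation. At a label, closure turns truth of the unfolded body into membership.
    sound : ∀ φ e r s → Closed φ e → ClosedEnv e →
            Win (step ⟨ φ , e , r , s ⟩) → Sat R r (tr φ e s)
    sound (t ≐ u) e r pos c ce w = Win-≐⁻ t u e r pos w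
    sound (t ≐ u) e r neg c ce w = Win-≐⁻ t u e r neg w
    sound (t ≺ u) e r pos c ce w = Win-≺⁻ t u e r pos w
    sound (t ≺ u) e r neg c ce w = Win-≺⁻ t u e r neg w
    sound falsum e r neg c ce w = id
    sound (¬ˢ φ) e r s c ce (move w) = sound φ e r (flip s) c ce w
    sound (φ ∧ˢ ψ) e r pos (b , c , d) ce (both w w′) =
      sound φ e r pos (⊔≤ˡ b , c) ce w , sound ψ e r pos (⊔≤ʳ {varsˢ φ} b , d) ce w′
    sound (φ ∧ˢ ψ) e r neg (b , c , d) ce (left w) = inj₁ (sound φ e r neg (⊔≤ˡ b , c) ce w)
    sound (φ ∧ˢ ψ) e r neg (b , c , d) ce (right w) = inj₂ (sound ψ e r neg (⊔≤ʳ {varsˢ φ} b , d) ce w)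
    sound (φ ∨ˢ ψ) e r pos (b , c , d) ce (left w) = inj₁ (sound φ e r pos (⊔≤ˡ b , c) ce w)
    sound (φ ∨ˢ ψ) e r pos (b , c , d) ce (right w) = inj₂ (sound ψ e r pos (⊔≤ʳ {varsˢ φ} b , d) ce w)
    sound (φ ∨ˢ ψ) e r neg (b , c , d) ce (both w w′) =
      sound φ e r neg (⊔≤ˡ b , c) ce w , sound ψ e r neg (⊔≤ʳ {varsˢ φ} b , d) ce w′
    sound (∃ˢ x φ) e r pos (b , c) ce (some n w) = n , sound φ e _ pos (⊔≤ʳ {suc x} b , c) ce w
    sound (∃ˢ x φ) e r neg (b , c) ce (every w) n = sound φ e _ neg (⊔≤ʳ {suc x} b , c) ce (w n)
    sound (∀ˢ x φ) e r pos (b , c) ce (every w) n = sound φ e _ pos (⊔≤ʳ {suc x} b , c) ce (w n)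
    sound (∀ˢ x φ) e r neg (b , c) ce (some n w) = n , sound φ e _ neg (⊔≤ʳ {suc x} b , c) ce w
    sound (claim L) e r s c ce w with refOf L e in eq
    sound (claim L) e r s c ce (move w) | just (ψ , e′) =
      sound (lab L ψ) e′ r s (proj₁ (refOf-closed L e ce eq)) (proj₂ (refOf-closed L e ce eq)) w
    sound (lab L φ) e r s c@(b , _ , d) ce (move w) =
      apply-rule L φ e s c (sound φ (bind L φ e e) r s (b , d) (c , ce , ce) w)

  module Complete (em : ExcludedMiddle 0ℓ) where

    InR : ℕ → Set
    InR n = Σ SCL λ φ → Σ Env λ e → Σ Sign λ s → Σ Assignment λ r →
            n ≡ key φ e s r × Win (step ⟨ φ , e , r , s ⟩)

    R : RelAsg (1 ∷ [])
    R zero (n ∷ []) = ⌊ em {InR n} ⌋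

    member-intro : ∀ φ e r s → Win (step ⟨ φ , e , r , s ⟩) → Sat R r (member φ e s)
    member-intro φ e r s w = fromWitness (φ , e , s , r , ⟦keyᵗ⟧ φ e s r , w)

    -- The key determines the occurrence and the sign, but the assignment only below `N`; `Win-cong`
    -- bridges the difference.
    member-elim : ∀ φ e r s → varsˢ φ ≤ N → varsᵉ≤ N e →
                  Sat R r (member φ e s) → Win (step ⟨ φ , e , r , s ⟩)
    member-elim φ e r s b be p with toWitness p
    ... | φ′ , e′ , s′ , r′ , eq , w
      with pair-injective (trans (sym (⟦keyᵗ⟧ φ e s r)) eq)
    ... | eq₁ , eq₂ with nodeCode-injective {φ} {e} {s} {φ′} {e′} {s′} eq₁
    ... | refl , refl , refl = Win-cong N φ e s b be (Agree-sym (codeAsg-injective N eq₂)) w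

    -- Structural in `φ`, unlike `sound`: membership in `R` at a label or claim already means that
    -- the position is won, so no loop is followed.
    complete : ∀ φ e r s → varsˢ φ ≤ N → varsᵉ≤ N e →
               Sat R r (tr φ e s) → Win (step ⟨ φ , e , r , s ⟩)
    complete (t ≐ u) e r pos b be p = Win-≐ t u e r pos p
    complete (t ≐ u) e r neg b be p = Win-≐ t u e r neg p
    complete (t ≺ u) e r pos b be p = Win-≺ t u e r pos p
    complete (t ≺ u) e r neg b be p = Win-≺ t u e r neg p
    complete falsum e r neg b be p = won
    complete (¬ˢ φ) e r s b be p = move (complete φ e r (flip s) b be p)
    complete (φ ∧ˢ ψ) e r pos b be (p , q) =
      both (complete φ e r pos (⊔≤ˡ b) be p) (complete ψ e r pos (⊔≤ʳ {varsˢ φ} b) be q)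
    complete (φ ∧ˢ ψ) e r neg b be (inj₁ p) = left (complete φ e r neg (⊔≤ˡ b) be p)
    complete (φ ∧ˢ ψ) e r neg b be (inj₂ q) = right (complete ψ e r neg (⊔≤ʳ {varsˢ φ} b) be q)
    complete (φ ∨ˢ ψ) e r pos b be (inj₁ p) = left (complete φ e r pos (⊔≤ˡ b) be p)
    complete (φ ∨ˢ ψ) e r pos b be (inj₂ q) = right (complete ψ e r pos (⊔≤ʳ {varsˢ φ} b) be q)
    complete (φ ∨ˢ ψ) e r neg b be (p , q) =
      both (complete φ e r neg (⊔≤ˡ b) be p) (complete ψ e r neg (⊔≤ʳ {varsˢ φ} b) be q)
    complete (∃ˢ x φ) e r pos b be (n , p) = some n (complete φ e _ pos (⊔≤ʳ {suc x} b) be p)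
    complete (∃ˢ x φ) e r neg b be p = every λ n → complete φ e _ neg (⊔≤ʳ {suc x} b) be (p n)
    complete (∀ˢ x φ) e r pos b be p = every λ n → complete φ e _ pos (⊔≤ʳ {suc x} b) be (p n)
    complete (∀ˢ x φ) e r neg b be (n , p) = some n (complete φ e _ neg (⊔≤ʳ {suc x} b) be p)
    complete (claim L) e r s b be p with refOf L e in eq
    ... | just (ψ , e′) = move (member-elim (lab L ψ) e′ r s
            (proj₁ (refOf-vars L e be eq)) (proj₂ (refOf-vars L e be eq)) p)
    complete (lab L φ) e r s b be p = member-elim (lab L φ) e r s b be p

    closed : ∀ φ e r → varsˢ φ ≤ N → varsᵉ≤ N e → Sat R r (closure φ e)
    closed (t ≐ u) e r b be = id
    closed (t ≺ u) e r b be = id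
    closed falsum e r b be = id
    closed (¬ˢ φ) e r b be = closed φ e r b be
    closed (φ ∧ˢ ψ) e r b be = closed φ e r (⊔≤ˡ b) be , closed ψ e r (⊔≤ʳ {varsˢ φ} b) be
    closed (φ ∨ˢ ψ) e r b be = closed φ e r (⊔≤ˡ b) be , closed ψ e r (⊔≤ʳ {varsˢ φ} b) be
    closed (∃ˢ x φ) e r b be = closed φ e r (⊔≤ʳ {suc x} b) be
    closed (∀ˢ x φ) e r b be = closed φ e r (⊔≤ʳ {suc x} b) be
    closed (claim L) e r b be = id
    closed (lab L φ) e r b be =
      (rules pos , rules neg) , closed φ (bind L φ e e) r b (b , be , be)
      where
      rules : ∀ s → Sat R r (rule L φ e s)
      rules s = ∀ᶠ*-intro R N (premise⇒member L φ e s) (λ r′ → holds r′ em) r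
        where
        holds : ∀ r′ → Dec (Sat R r′ (tr φ (bind L φ e e) s)) →
                Sat R r′ (premise⇒member L φ e s)
        holds r′ (no ¬p) = inj₁ ¬p
        holds r′ (yes p) = inj₂ (member-intro (lab L φ) e r′ s
          (move (complete φ (bind L φ e e) r′ s b (b , be , be) p)))

  Win⇔Θ : ExcludedMiddle 0ℓ → ∀ φ r → varsˢ φ ≤ N →
          Win (step ⟨ φ , ε , r , pos ⟩) ⇔ SatΠ¹₁ r (Θ φ)
  Win⇔Θ em φ r b = mk⇔ there back
    where
    there : Win (step ⟨ φ , ε , r , pos ⟩) → SatΠ¹₁ r (Θ φ)
    there w R with em {Sat R r (closure φ ε)}
    ... | yes c = inj₂ (Sound.sound R r φ ε r pos (b , c) tt w)
    ... | no ¬c = inj₁ ¬c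
    back : SatΠ¹₁ r (Θ φ) → Win (step ⟨ φ , ε , r , pos ⟩)
    back p with p (Complete.R em)
    ... | inj₁ ¬c = ⊥-elim (¬c (Complete.closed em φ ε r b tt))
    ... | inj₂ q = Complete.complete em φ ε r pos b tt q

SCL⇒Π¹₁ : ExcludedMiddle 0ℓ → ∀ k X → SCLDefinable k X → IsΠ¹₁ k X
SCL⇒Π¹₁ em k X (φ , _ , def) =
  -- Keys mention every variable below `N`, even those not free in `φ`. The zeroing prefix binds the
  -- ones outside the tuple, and `n` bounds all variables of `θ`.
  1 ∷ [] , zeroedᶠ k n θ , zeroedᶠ-free k n θ (m≤n+m n k) id , λ m →
    meaning m ⇔-∘ (Games.winning⇔Win em _ ⇔-∘ def m)
  where
  N = varsˢ φ
  θ = FromSCL.Θ N φ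
  n = varsᶠ θ
  meaning : ∀ m → Win (step ⟨ φ , ε , tupleAsg m , pos ⟩) ⇔ SatΠ¹₁ (tupleAsg m) (zeroedᶠ k n θ)
  meaning m = mk⇔
    (λ w R → from (Sat-zeroed R k n θ r) (to eqv (Win-cong N φ ε pos ≤-refl tt (Agree-sym ag) w) R))
    (λ p → Win-cong N φ ε pos ≤-refl tt ag (from eqv λ R → to (Sat-zeroed R k n θ r) (p R)))
    where
    r = tupleAsg m
    ag : Agree N (zeros k n r) r
    ag {i} _ = zeros-id k n r (tupleAsg-zero m) i
    eqv = FromSCL.Win⇔Θ N em φ (zeros k n r) ≤-refl

-- From Π¹₁ to SCL

-- Variables 0, …, 7 belong to the game; the variable x of ψ becomes 8 + x, so
-- that updates of game variables leave unshift r unchanged definitionally.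

unshift : Assignment → Assignment
unshift r y = r (8 + y)

shiftᵗ : Term → Term
shiftᵗ (var x) = var (8 + x)
shiftᵗ 𝟘 = 𝟘
shiftᵗ 𝟙 = 𝟙
shiftᵗ (t ⊕ u) = shiftᵗ t ⊕ shiftᵗ u
shiftᵗ (t ⊗ u) = shiftᵗ t ⊗ shiftᵗ u

⟦shiftᵗ⟧ : ∀ t r → ⟦ shiftᵗ t ⟧ r ≡ ⟦ t ⟧ (unshift r)
⟦shiftᵗ⟧ (var x) r = refl
⟦shiftᵗ⟧ 𝟘 r = refl
⟦shiftᵗ⟧ 𝟙 r = refl
⟦shiftᵗ⟧ (t ⊕ u) r = cong₂ _+_ (⟦shiftᵗ⟧ t r) (⟦shiftᵗ⟧ u r)
⟦shiftᵗ⟧ (t ⊗ u) r = cong₂ _*_ (⟦shiftᵗ⟧ t r) (⟦shiftᵗ⟧ u r)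

vecᵗ : ∀ {n} → Vec Term n → Term
vecᵗ [] = 𝟘
vecᵗ (t ∷ ts) = pairᵗ (shiftᵗ t) (vecᵗ ts)

⟦vecᵗ⟧ : ∀ {n} (ts : Vec Term n) r →
         ⟦ vecᵗ ts ⟧ r ≡ codeVec (Vec.map (λ t → ⟦ t ⟧ (unshift r)) ts)
⟦vecᵗ⟧ [] r = refl
⟦vecᵗ⟧ (t ∷ ts) r =
  trans (⟦pairᵗ⟧ (shiftᵗ t) (vecᵗ ts) r) (cong₂ pair (⟦shiftᵗ⟧ t r) (⟦vecᵗ⟧ ts r))

-- A history is a list of entries pair question answer, coded by 0 and
-- suc (pair history entry).

cons : ℕ → ℕ → ℕ
cons h x = suc (pair h x)

consᵗ : Term → Term → Term
consᵗ t u = 𝟙 ⊕ pairᵗ t u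

⟦consᵗ⟧ : ∀ t u r → ⟦ consᵗ t u ⟧ r ≡ cons (⟦ t ⟧ r) (⟦ u ⟧ r)
⟦consᵗ⟧ t u r = cong suc (⟦pairᵗ⟧ t u r)

-- The history is constrained by an equation rather than by its index, since unification cannot
-- invert `cons`.
data _∈ʰ_ (x : ℕ) : ℕ → Set where
  here  : ∀ {h h′} → h′ ≡ cons h x → x ∈ʰ h′
  there : ∀ {h h′ y} → h′ ≡ cons h y → x ∈ʰ h → x ∈ʰ h′

∈ʰ-cons⁻ : ∀ {x h y} → x ∈ʰ cons h y → x ≡ y ⊎ x ∈ʰ h
∈ʰ-cons⁻ (here eq) = inj₁ (sym (proj₂ (pair-injective (suc-injective eq))))
∈ʰ-cons⁻ (there eq m) = inj₂ (subst (_ ∈ʰ_) (sym (proj₁ (pair-injective (suc-injective eq)))) m)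

-- Is the value of variable 2 an entry of the history in variable 0?
search : SCL
search = ∃ˢ 3 ((var 0 ≐ consᵗ (var 3) (var 2)) ∨ˢ
               ∃ˢ 4 ((var 0 ≐ consᵗ (var 3) (var 4)) ∧ˢ
                     ∃ˢ 0 ((var 0 ≐ var 3) ∧ˢ claim 1)))

-- Induction on the winning derivation. The claim resolves to `lab 1 search` in the same environment
-- `e`, so each pass through the loop is an instance of the statement with one entry removed.
Win-search⁻ : ∀ e r → Win (step ⟨ lab 1 search , e , r , pos ⟩) → r 2 ∈ʰ r 0
Win-search⁻ e r (move (some h (left w))) =
  here (trans (Win-≐⁻ (var 0) (consᵗ (var 3) (var 2)) (bind 1 search e e) (r [ h / 3 ]) pos w)
              (⟦consᵗ⟧ (var 3) (var 2) (r [ h / 3 ])))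
Win-search⁻ e r (move (some h (right (some y (both w (some h′ (both w′ (move w″)))))))) =
  there (trans (Win-≐⁻ (var 0) (consᵗ (var 3) (var 4)) (bind 1 search e e) r₁ pos w)
               (⟦consᵗ⟧ (var 3) (var 4) r₁))
        (subst (r 2 ∈ʰ_)
               (Win-≐⁻ (var 0) (var 3) (bind 1 search e e) (r₁ [ h′ / 0 ]) pos w′)
               (Win-search⁻ e (r₁ [ h′ / 0 ]) w″))
  where r₁ = (r [ h / 3 ]) [ y / 4 ]

Win-search : ∀ e r {h} → r 0 ≡ h → r 2 ∈ʰ h → Win (step ⟨ lab 1 search , e , r , pos ⟩)
Win-search e r r0 (here {h} eq) = move (some h (left
  (Win-≐ (var 0) (consᵗ (var 3) (var 2)) (bind 1 search e e) (r [ h / 3 ]) pos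
         (trans r0 (trans eq (sym (⟦consᵗ⟧ (var 3) (var 2) (r [ h / 3 ]))))))))
Win-search e r r0 (there {h} {y = y} eq m) = move (some h (right (some y (both
  (Win-≐ (var 0) (consᵗ (var 3) (var 4)) (bind 1 search e e) r₁ pos
         (trans r0 (trans eq (sym (⟦consᵗ⟧ (var 3) (var 4) r₁)))))
  (some h (both (Win-≐ (var 0) (var 3) (bind 1 search e e) (r₁ [ h / 0 ]) pos refl)
                (move (Win-search e (r₁ [ h / 0 ]) refl m))))))))
  where r₁ = (r [ h / 3 ]) [ y / 4 ]

recorded : Term → SCL
recorded t = ∃ˢ 2 ((var 2 ≐ t) ∧ˢ lab 1 search)

Win-recorded : ∀ t e r v → (∀ a → ⟦ t ⟧ (r [ a / 2 ]) ≡ v) →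
               Win (step ⟨ recorded t , e , r , pos ⟩) ⇔ v ∈ʰ r 0
Win-recorded t e r v eval = mk⇔
  (Win-search⁻ e _ ∘ Win-let⁻ 2 t (lab 1 search) e r v eval)
  (Win-let 2 t (lab 1 search) e r v eval ∘ Win-search e _ refl)

-- The answer 0 means no; the answer suc w means yes, with witness w.

answered : Sign → Term → SCL
answered pos k = ∃ˢ 5 (recorded (pairᵗ k (𝟙 ⊕ var 5)))
answered neg k = recorded (pairᵗ k 𝟘)

Answered : ℕ → Sign → ℕ → Set
Answered h pos q = ∃ λ w → pair q (suc w) ∈ʰ h
Answered h neg q = pair q 0 ∈ʰ h

-- The question may depend only on the shifted variables, so that overwriting variables 5 and 2
-- during the search leaves its value unchanged.
Win-answered : ∀ s k (f : Assignment → ℕ) → (∀ r → ⟦ k ⟧ r ≡ f (unshift r)) → ∀ e r →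
               Win (step ⟨ answered s k , e , r , pos ⟩) ⇔ Answered (r 0) s (f (unshift r))
Win-answered pos k f eval e r = mk⇔
  (λ { (some w m) → w , to (rec w) m }) (λ { (w , m) → some w (from (rec w) m) })
  where
  rec : ∀ w → Win (step ⟨ recorded (pairᵗ k (𝟙 ⊕ var 5)) , e , r [ w / 5 ] , pos ⟩) ⇔
              pair (f (unshift r)) (suc w) ∈ʰ r 0
  rec w = Win-recorded (pairᵗ k (𝟙 ⊕ var 5)) e (r [ w / 5 ]) _ λ a →
    trans (⟦pairᵗ⟧ k (𝟙 ⊕ var 5) ((r [ w / 5 ]) [ a / 2 ]))
          (cong (λ q → pair q (suc w)) (eval ((r [ w / 5 ]) [ a / 2 ])))
Win-answered neg k f eval e r = Win-recorded (pairᵗ k 𝟘) e r _ λ a →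
  trans (⟦pairᵗ⟧ k 𝟘 (r [ a / 2 ])) (cong (λ q → pair q 0) (eval (r [ a / 2 ])))

-- The interrogation game.

module FromΠ¹₁ {ar : List ℕ} (N : ℕ) where

  Fm : Set
  Fm = SOF ar

  relKey : (j : Fin (length ar)) → Vec ℕ (lookup ar j) → ℕ
  relKey j v = pair 0 (pair (toℕ j) (codeVec v))

  relKeyᵗ : (j : Fin (length ar)) → Vec Term (lookup ar j) → Term
  relKeyᵗ j ts = pairᵗ 𝟘 (pairᵗ (numeral (toℕ j)) (vecᵗ ts))

  values : ∀ {n} → Vec Term n → Assignment → Vec ℕ n
  values ts r = Vec.map (λ t → ⟦ t ⟧ r) ts

  ⟦relKeyᵗ⟧ : ∀ j ts r → ⟦ relKeyᵗ j ts ⟧ r ≡ relKey j (values ts (unshift r))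
  ⟦relKeyᵗ⟧ j ts r =
    trans (⟦pairᵗ⟧ 𝟘 (pairᵗ (numeral (toℕ j)) (vecᵗ ts)) r)
      (cong (pair 0) (trans (⟦pairᵗ⟧ (numeral (toℕ j)) (vecᵗ ts) r)
        (cong₂ pair (⟦numeral⟧ (toℕ j)) (⟦vecᵗ⟧ ts r))))

  relKey-injective : ∀ {j v j′ v′} → relKey j v ≡ relKey j′ v′ → (j , v) ≡ (j′ , v′)
  relKey-injective eq with pair-injective (proj₂ (pair-injective eq))
  ... | eq₁ , eq₂ with toℕ-injective eq₁
  ...   | refl = cong (_ ,_) (codeVec-injective eq₂)

  -- The question whether ∃ x φ (for pos) or ∃ x ¬ φ (for neg) holds at r.
  quantKey : Sign → ℕ → Fm → Assignment → ℕ
  quantKey s x φ r = pair 1 (pair (quantCode s x φ) (codeAsg N r))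

  quantKeyᵗ : Sign → ℕ → Fm → Term
  quantKeyᵗ s x φ = pairᵗ 𝟙 (pairᵗ (numeral (quantCode s x φ)) (asgᵗ (8 +_) N))

  ⟦quantKeyᵗ⟧ : ∀ s x φ r → ⟦ quantKeyᵗ s x φ ⟧ r ≡ quantKey s x φ (unshift r)
  ⟦quantKeyᵗ⟧ s x φ r =
    trans (⟦pairᵗ⟧ 𝟙 (pairᵗ (numeral (quantCode s x φ)) (asgᵗ (8 +_) N)) r)
      (cong (pair 1) (trans (⟦pairᵗ⟧ (numeral (quantCode s x φ)) (asgᵗ (8 +_) N) r)
        (cong₂ pair (⟦numeral⟧ (quantCode s x φ)) (⟦asgᵗ⟧ (8 +_) N r))))

  relKey≢quantKey : ∀ j v s x φ r → relKey j v ≢ quantKey s x φ r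
  relKey≢quantKey j v s x φ r eq with () ← proj₁ (pair-injective eq)

  quantKey-injective : ∀ {s x φ r s′ x′ φ′ r′} → quantKey s x φ r ≡ quantKey s′ x′ φ′ r′ →
                       (s ≡ s′ × x ≡ x′ × φ ≡ φ′) × Agree N r r′
  quantKey-injective {s} {x} {φ} {r} {s′} {x′} {φ′} eq
    with pair-injective (proj₂ (pair-injective eq))
  ... | eq₁ , eq₂ =
    quantCode-injective {s = s} {x} {s′} {x′} {φ} {φ′} eq₁ , codeAsg-injective N eq₂

  -- The two signs are not complementary: each demands recorded answers that settle `φ`, so missing
  -- answers may leave neither won. Quantified formulas are not unfolded, and `∀ᶠ` is read as the
  -- absence of a counterexample, whence the flipped sign.
  ev : Fm → Sign → SCL
  ev (t ≐ u) pos = shiftᵗ t ≐ shiftᵗ u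
  ev (t ≐ u) neg = ¬ˢ (shiftᵗ t ≐ shiftᵗ u)
  ev (t ≺ u) pos = shiftᵗ t ≺ shiftᵗ u
  ev (t ≺ u) neg = ¬ˢ (shiftᵗ t ≺ shiftᵗ u)
  ev falsum pos = falsum
  ev falsum neg = ¬ˢ falsum
  ev (rel j ts) s = answered s (relKeyᵗ j ts)
  ev (¬ᶠ φ) s = ev φ (flip s)
  ev (φ ∧ᶠ ψ) pos = ev φ pos ∧ˢ ev ψ pos
  ev (φ ∧ᶠ ψ) neg = ev φ neg ∨ˢ ev ψ neg
  ev (φ ∨ᶠ ψ) pos = ev φ pos ∨ˢ ev ψ pos
  ev (φ ∨ᶠ ψ) neg = ev φ neg ∧ˢ ev ψ neg
  ev (∃ᶠ x φ) s = answered s (quantKeyᵗ pos x φ)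
  ev (∀ᶠ x φ) s = answered (flip s) (quantKeyᵗ neg x φ)

  Ev : ℕ → Sign → Assignment → Fm → Set
  Ev h s r (t ≐ u) = Signed s (⟦ t ⟧ r ≡ ⟦ u ⟧ r)
  Ev h s r (t ≺ u) = Signed s (⟦ t ⟧ r < ⟦ u ⟧ r)
  Ev h s r falsum = Signed s ⊥
  Ev h s r (rel j ts) = Answered h s (relKey j (values ts r))
  Ev h s r (¬ᶠ φ) = Ev h (flip s) r φ
  Ev h pos r (φ ∧ᶠ ψ) = Ev h pos r φ × Ev h pos r ψ
  Ev h neg r (φ ∧ᶠ ψ) = Ev h neg r φ ⊎ Ev h neg r ψ
  Ev h pos r (φ ∨ᶠ ψ) = Ev h pos r φ ⊎ Ev h pos r ψ
  Ev h neg r (φ ∨ᶠ ψ) = Ev h neg r φ × Ev h neg r ψ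
  Ev h s r (∃ᶠ x φ) = Answered h s (quantKey pos x φ r)
  Ev h s r (∀ᶠ x φ) = Answered h (flip s) (quantKey neg x φ r)

  module _ (e : Env) (r : Assignment) where

    Win-ev⁻ : ∀ s φ → Win (step ⟨ ev φ s , e , r , pos ⟩) → Ev (r 0) s (unshift r) φ
    Win-ev⁻ pos (t ≐ u) w =
      subst₂ _≡_ (⟦shiftᵗ⟧ t r) (⟦shiftᵗ⟧ u r) (Win-≐⁻ (shiftᵗ t) (shiftᵗ u) e r pos w)
    Win-ev⁻ neg (t ≐ u) (move w) =
      Win-≐⁻ (shiftᵗ t) (shiftᵗ u) e r neg w ∘ subst₂ _≡_ (sym (⟦shiftᵗ⟧ t r)) (sym (⟦shiftᵗ⟧ u r))
    Win-ev⁻ pos (t ≺ u) w =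
      subst₂ _<_ (⟦shiftᵗ⟧ t r) (⟦shiftᵗ⟧ u r) (Win-≺⁻ (shiftᵗ t) (shiftᵗ u) e r pos w)
    Win-ev⁻ neg (t ≺ u) (move w) =
      Win-≺⁻ (shiftᵗ t) (shiftᵗ u) e r neg w ∘ subst₂ _<_ (sym (⟦shiftᵗ⟧ t r)) (sym (⟦shiftᵗ⟧ u r))
    Win-ev⁻ neg falsum w = id
    Win-ev⁻ s (rel j ts) = to (Win-answered s (relKeyᵗ j ts) (relKey j ∘ values ts) (⟦relKeyᵗ⟧ j ts) e r)
    Win-ev⁻ s (¬ᶠ φ) w = Win-ev⁻ (flip s) φ w
    Win-ev⁻ pos (φ ∧ᶠ ψ) (both w w′) = Win-ev⁻ pos φ w , Win-ev⁻ pos ψ w′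
    Win-ev⁻ neg (φ ∧ᶠ ψ) (left w) = inj₁ (Win-ev⁻ neg φ w)
    Win-ev⁻ neg (φ ∧ᶠ ψ) (right w) = inj₂ (Win-ev⁻ neg ψ w)
    Win-ev⁻ pos (φ ∨ᶠ ψ) (left w) = inj₁ (Win-ev⁻ pos φ w)
    Win-ev⁻ pos (φ ∨ᶠ ψ) (right w) = inj₂ (Win-ev⁻ pos ψ w)
    Win-ev⁻ neg (φ ∨ᶠ ψ) (both w w′) = Win-ev⁻ neg φ w , Win-ev⁻ neg ψ w′
    Win-ev⁻ s (∃ᶠ x φ) =
      to (Win-answered s (quantKeyᵗ pos x φ) (quantKey pos x φ) (⟦quantKeyᵗ⟧ pos x φ) e r)
    Win-ev⁻ s (∀ᶠ x φ) =
      to (Win-answered (flip s) (quantKeyᵗ neg x φ) (quantKey neg x φ) (⟦quantKeyᵗ⟧ neg x φ) e r)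

    Win-ev : ∀ s φ → Ev (r 0) s (unshift r) φ → Win (step ⟨ ev φ s , e , r , pos ⟩)
    Win-ev pos (t ≐ u) p =
      Win-≐ (shiftᵗ t) (shiftᵗ u) e r pos (subst₂ _≡_ (sym (⟦shiftᵗ⟧ t r)) (sym (⟦shiftᵗ⟧ u r)) p)
    Win-ev neg (t ≐ u) p =
      move (Win-≐ (shiftᵗ t) (shiftᵗ u) e r neg (p ∘ subst₂ _≡_ (⟦shiftᵗ⟧ t r) (⟦shiftᵗ⟧ u r)))
    Win-ev pos (t ≺ u) p =
      Win-≺ (shiftᵗ t) (shiftᵗ u) e r pos (subst₂ _<_ (sym (⟦shiftᵗ⟧ t r)) (sym (⟦shiftᵗ⟧ u r)) p)
    Win-ev neg (t ≺ u) p =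
      move (Win-≺ (shiftᵗ t) (shiftᵗ u) e r neg (p ∘ subst₂ _<_ (⟦shiftᵗ⟧ t r) (⟦shiftᵗ⟧ u r)))
    Win-ev neg falsum p = move won
    Win-ev s (rel j ts) = from (Win-answered s (relKeyᵗ j ts) (relKey j ∘ values ts) (⟦relKeyᵗ⟧ j ts) e r)
    Win-ev s (¬ᶠ φ) p = Win-ev (flip s) φ p
    Win-ev pos (φ ∧ᶠ ψ) (p , q) = both (Win-ev pos φ p) (Win-ev pos ψ q)
    Win-ev neg (φ ∧ᶠ ψ) (inj₁ p) = left (Win-ev neg φ p)
    Win-ev neg (φ ∧ᶠ ψ) (inj₂ q) = right (Win-ev neg ψ q)
    Win-ev pos (φ ∨ᶠ ψ) (inj₁ p) = left (Win-ev pos φ p)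
    Win-ev pos (φ ∨ᶠ ψ) (inj₂ q) = right (Win-ev pos ψ q)
    Win-ev neg (φ ∨ᶠ ψ) (p , q) = both (Win-ev neg φ p) (Win-ev neg ψ q)
    Win-ev s (∃ᶠ x φ) =
      from (Win-answered s (quantKeyᵗ pos x φ) (quantKey pos x φ) (⟦quantKeyᵗ⟧ pos x φ) e r)
    Win-ev s (∀ᶠ x φ) =
      from (Win-answered (flip s) (quantKeyᵗ neg x φ) (quantKey neg x φ) (⟦quantKeyᵗ⟧ neg x φ) e r)

  Answered-mono : ∀ {h h′} s {q} → (∀ {x} → x ∈ʰ h → x ∈ʰ h′) → Answered h s q → Answered h′ s q
  Answered-mono pos sub (w , m) = w , sub m
  Answered-mono neg sub m = sub m

  -- No clause of `Ev` asks for the absence of an entry, so longer histories preserve it under `neg`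
  -- as well.
  Ev-mono : ∀ {h h′} s r φ → (∀ {x} → x ∈ʰ h → x ∈ʰ h′) → Ev h s r φ → Ev h′ s r φ
  Ev-mono s r (t ≐ u) sub p = p
  Ev-mono s r (t ≺ u) sub p = p
  Ev-mono s r falsum sub p = p
  Ev-mono s r (rel j ts) sub p = Answered-mono s sub p
  Ev-mono s r (¬ᶠ φ) sub p = Ev-mono (flip s) r φ sub p
  Ev-mono pos r (φ ∧ᶠ ψ) sub (p , q) = Ev-mono pos r φ sub p , Ev-mono pos r ψ sub q
  Ev-mono neg r (φ ∧ᶠ ψ) sub (inj₁ p) = inj₁ (Ev-mono neg r φ sub p)
  Ev-mono neg r (φ ∧ᶠ ψ) sub (inj₂ q) = inj₂ (Ev-mono neg r ψ sub q)
  Ev-mono pos r (φ ∨ᶠ ψ) sub (inj₁ p) = inj₁ (Ev-mono pos r φ sub p)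
  Ev-mono pos r (φ ∨ᶠ ψ) sub (inj₂ q) = inj₂ (Ev-mono pos r ψ sub q)
  Ev-mono neg r (φ ∨ᶠ ψ) sub (p , q) = Ev-mono neg r φ sub p , Ev-mono neg r ψ sub q
  Ev-mono s r (∃ᶠ x φ) sub p = Answered-mono s sub p
  Ev-mono s r (∀ᶠ x φ) sub p = Answered-mono (flip s) sub p

  quantKey-cong : ∀ s x φ {r r′} → Agree N r r′ → quantKey s x φ r ≡ quantKey s x φ r′
  quantKey-cong s x φ ag = cong (λ c → pair 1 (pair (quantCode s x φ) c)) (codeAsg-cong N ag)

  Ev-cong : ∀ {h} s {r r′} φ → varsᶠ φ ≤ N → Agree N r r′ → Ev h s r φ → Ev h s r′ φ
  Ev-cong s (t ≐ u) b ag = subst₂ (λ m n → Signed s (m ≡ n))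
    (⟦⟧-cong t (⊔≤ˡ b) ag) (⟦⟧-cong u (⊔≤ʳ {varsᵗ t} b) ag)
  Ev-cong s (t ≺ u) b ag = subst₂ (λ m n → Signed s (m < n))
    (⟦⟧-cong t (⊔≤ˡ b) ag) (⟦⟧-cong u (⊔≤ʳ {varsᵗ t} b) ag)
  Ev-cong s falsum b ag p = p
  Ev-cong {h} s (rel j ts) b ag = subst (Answered h s ∘ relKey j) (⟦⟧ᵛ-cong ts b ag)
  Ev-cong s (¬ᶠ φ) b ag p = Ev-cong (flip s) φ b ag p
  Ev-cong pos (φ ∧ᶠ ψ) b ag (p , q) =
    Ev-cong pos φ (⊔≤ˡ b) ag p , Ev-cong pos ψ (⊔≤ʳ {varsᶠ φ} b) ag q
  Ev-cong neg (φ ∧ᶠ ψ) b ag (inj₁ p) = inj₁ (Ev-cong neg φ (⊔≤ˡ b) ag p)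
  Ev-cong neg (φ ∧ᶠ ψ) b ag (inj₂ q) = inj₂ (Ev-cong neg ψ (⊔≤ʳ {varsᶠ φ} b) ag q)
  Ev-cong pos (φ ∨ᶠ ψ) b ag (inj₁ p) = inj₁ (Ev-cong pos φ (⊔≤ˡ b) ag p)
  Ev-cong pos (φ ∨ᶠ ψ) b ag (inj₂ q) = inj₂ (Ev-cong pos ψ (⊔≤ʳ {varsᶠ φ} b) ag q)
  Ev-cong neg (φ ∨ᶠ ψ) b ag (p , q) =
    Ev-cong neg φ (⊔≤ˡ b) ag p , Ev-cong neg ψ (⊔≤ʳ {varsᶠ φ} b) ag q
  Ev-cong {h} s (∃ᶠ x φ) b ag = subst (Answered h s) (quantKey-cong pos x φ ag)
  Ev-cong {h} s (∀ᶠ x φ) b ag = subst (Answered h (flip s)) (quantKey-cong neg x φ ag)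

  -- There are two ways to catch a quantifier answer: a no, when the value of variable `8 + x` is an
  -- instance after all, or a yes, when that value is the recorded witness and fails.
  refutesAt : Sign → ℕ → Fm → SCL
  refutesAt s x φ =
    (recorded (pairᵗ (var 1) 𝟘) ∧ˢ ev φ s) ∨ˢ
    (recorded (pairᵗ (var 1) (𝟙 ⊕ var (8 + x))) ∧ˢ ev φ (flip s))

  -- The question refers to the assignment before `8 + x` is overwritten by the candidate value, so
  -- it is stored in variable 1 first.
  refuted : Sign → ℕ → Fm → SCL
  refuted s x φ = ∃ˢ 1 ((var 1 ≐ quantKeyᵗ s x φ) ∧ˢ ∃ˢ (8 + x) (refutesAt s x φ))

  Refuted : ℕ → Sign → ℕ → Fm → Assignment → Set
  Refuted h s x φ r = ∃ λ b →
    (pair (quantKey s x φ r) 0 ∈ʰ h × Ev h s (r [ b / x ]) φ) ⊎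
    (pair (quantKey s x φ r) (suc b) ∈ʰ h × Ev h (flip s) (r [ b / x ]) φ)

  module _ (s : Sign) (x : ℕ) (φ : Fm) (e : Env) (r : Assignment) where
    private
      k : ℕ
      k = quantKey s x φ (unshift r)

      r₁ : ℕ → Assignment
      r₁ b = (r [ k / 1 ]) [ b / 8 + x ]

      no⇔ : ∀ b → Win (step ⟨ recorded (pairᵗ (var 1) 𝟘) , e , r₁ b , pos ⟩) ⇔ pair k 0 ∈ʰ r 0
      no⇔ b = Win-recorded (pairᵗ (var 1) 𝟘) e (r₁ b) _ λ a →
        ⟦pairᵗ⟧ (var 1) 𝟘 (r₁ b [ a / 2 ])

      yes⇔ : ∀ b → Win (step ⟨ recorded (pairᵗ (var 1) (𝟙 ⊕ var (8 + x))) , e , r₁ b , pos ⟩) ⇔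
                   pair k (suc b) ∈ʰ r 0
      yes⇔ b = Win-recorded (pairᵗ (var 1) (𝟙 ⊕ var (8 + x))) e (r₁ b) _ λ a →
        trans (⟦pairᵗ⟧ (var 1) (𝟙 ⊕ var (8 + x)) (r₁ b [ a / 2 ]))
              (cong (λ n → pair k (suc n)) (update-same (r [ k / 1 ]) b (8 + x)))

      evalKey : ∀ a → ⟦ quantKeyᵗ s x φ ⟧ (r [ a / 1 ]) ≡ k
      evalKey a = ⟦quantKeyᵗ⟧ s x φ (r [ a / 1 ])

      refutes⁻ : Win (step ⟨ ∃ˢ (8 + x) (refutesAt s x φ) , e , r [ k / 1 ] , pos ⟩) →
                 Refuted (r 0) s x φ (unshift r)
      refutes⁻ (some b (left (both w w′))) = b , inj₁ (to (no⇔ b) w , Win-ev⁻ e (r₁ b) s φ w′)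
      refutes⁻ (some b (right (both w w′))) =
        b , inj₂ (to (yes⇔ b) w , Win-ev⁻ e (r₁ b) (flip s) φ w′)

      refutes : Refuted (r 0) s x φ (unshift r) →
                Win (step ⟨ ∃ˢ (8 + x) (refutesAt s x φ) , e , r [ k / 1 ] , pos ⟩)
      refutes (b , inj₁ (m , p)) = some b (left (both (from (no⇔ b) m) (Win-ev e (r₁ b) s φ p)))
      refutes (b , inj₂ (m , p)) =
        some b (right (both (from (yes⇔ b) m) (Win-ev e (r₁ b) (flip s) φ p)))

    Win-refuted : Win (step ⟨ refuted s x φ , e , r , pos ⟩) ⇔ Refuted (r 0) s x φ (unshift r)
    Win-refuted = mk⇔
      (refutes⁻ ∘ Win-let⁻ 1 (quantKeyᵗ s x φ) (∃ˢ (8 + x) (refutesAt s x φ)) e r k evalKey)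
      (Win-let 1 (quantKeyᵗ s x φ) (∃ˢ (8 + x) (refutesAt s x φ)) e r k evalKey ∘ refutes)

  -- Only quantifier answers can be caught: answers about relation symbols, given once per question,
  -- always describe some relation.
  inconsistent : Fm → SCL
  inconsistent (t ≐ u) = falsum
  inconsistent (t ≺ u) = falsum
  inconsistent falsum = falsum
  inconsistent (rel j ts) = falsum
  inconsistent (¬ᶠ φ) = inconsistent φ
  inconsistent (φ ∧ᶠ ψ) = inconsistent φ ∨ˢ inconsistent ψ
  inconsistent (φ ∨ᶠ ψ) = inconsistent φ ∨ˢ inconsistent ψ
  inconsistent (∃ᶠ x φ) = refuted pos x φ ∨ˢ inconsistent φ
  inconsistent (∀ᶠ x φ) = refuted neg x φ ∨ˢ inconsistent φ

  ∃ˢ* : ℕ → SCL → SCL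
  ∃ˢ* zero φ = φ
  ∃ˢ* (suc n) φ = ∃ˢ* n (∃ˢ (8 + n) φ)

  Win-∃ˢ*⁻ : ∀ n φ e r → Win (step ⟨ ∃ˢ* n φ , e , r , pos ⟩) →
             Σ Assignment λ r′ → r′ 0 ≡ r 0 × Win (step ⟨ φ , e , r′ , pos ⟩)
  Win-∃ˢ*⁻ zero φ e r w = r , refl , w
  Win-∃ˢ*⁻ (suc n) φ e r w with Win-∃ˢ*⁻ n (∃ˢ (8 + n) φ) e r w
  ... | r′ , eq , some a w′ = r′ [ a / 8 + n ] , eq , w′

  -- The assignment `r′` is obtained before any win is known, so the contrapositive is available
  -- too: if the prefixed formula is lost, `φ` is lost at `r′`.
  Win-∃ˢ* : ∀ n φ e r r₀ → Σ Assignment λ r′ →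
            r′ 0 ≡ r 0 × Agree n r₀ (unshift r′) ×
            (Win (step ⟨ φ , e , r′ , pos ⟩) → Win (step ⟨ ∃ˢ* n φ , e , r , pos ⟩))
  Win-∃ˢ* zero φ e r r₀ = r , refl , (λ ()) , id
  Win-∃ˢ* (suc n) φ e r r₀ with Win-∃ˢ* n (∃ˢ (8 + n) φ) e r r₀
  ... | r′ , eq , ag , k = r′ [ r₀ n / 8 + n ] , eq , ag′ , k ∘ some (r₀ n)
    where
    ag′ : Agree (suc n) r₀ (unshift (r′ [ r₀ n / 8 + n ]))
    ag′ {i} i<1+n with m≤n⇒m<n∨m≡n i<1+n
    ... | inj₁ (s≤s i<n) = trans (ag i<n) (sym (update-other (unshift r′) (r₀ n) (<⇒≢ i<n)))
    ... | inj₂ refl = sym (update-same (unshift r′) (r₀ n) n)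

  -- Variables 5 and 6 hold the question and the answer. The new history is built in variable 7,
  -- because under `∃ˢ 0` the old value of variable 0 can no longer be read.
  record-and-continue : SCL
  record-and-continue = ∃ˢ 7 ((var 7 ≐ consᵗ (var 0) (pairᵗ (var 5) (var 6))) ∧ˢ
                              ∃ˢ 0 ((var 0 ≐ var 7) ∧ˢ claim 0))

  round : Fm → SCL
  round ψ = (ev ψ pos ∨ˢ ∃ˢ* N (inconsistent ψ)) ∨ˢ ∃ˢ 5 (∀ˢ 6 record-and-continue)

  game : Fm → SCL
  game ψ = ∃ˢ 0 ((var 0 ≐ 𝟘) ∧ˢ lab 0 (round ψ))

  ⟦entryᵗ⟧ : ∀ r → ⟦ consᵗ (var 0) (pairᵗ (var 5) (var 6)) ⟧ r ≡ cons (r 0) (pair (r 5) (r 6))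
  ⟦entryᵗ⟧ r = trans (⟦consᵗ⟧ (var 0) (pairᵗ (var 5) (var 6)) r)
                     (cong (cons (r 0)) (⟦pairᵗ⟧ (var 5) (var 6) r))

  -- If R falsifies ψ, Abelard survives by answering truthfully about R.

  module Sound (em : ExcludedMiddle 0ℓ) (R : RelAsg ar) where
    open Games em using (stable)

    HonestRel : ∀ j → Vec ℕ (lookup ar j) → ℕ → Set
    HonestRel j v zero = ¬ T (R j v)
    HonestRel j v (suc _) = T (R j v)

    HonestQuant : Sign → ℕ → Fm → Assignment → ℕ → Set
    HonestQuant s x φ r zero = ∀ b → ¬ Signed s (Sat R (r [ b / x ]) φ)
    HonestQuant s x φ r (suc b) = Signed s (Sat R (r [ b / x ]) φ)

    -- Quantifying over all readings of `q` demands nothing of numbers that code no question. The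
    -- bound on `φ` makes its truth depend only on the coded part of `r`.
    Honest : ℕ → ℕ → Set
    Honest q a = (∀ j v → q ≡ relKey j v → HonestRel j v a) ×
                 (∀ s x φ r → varsᶠ φ ≤ N → q ≡ quantKey s x φ r → HonestQuant s x φ r a)

    Signed-cong : ∀ s (φ : Fm) {r r′} → varsᶠ φ ≤ N → Agree N r r′ →
                  Signed s (Sat R r φ) → Signed s (Sat R r′ φ)
    Signed-cong pos φ b ag p = Sat-cong R φ b ag p
    Signed-cong neg φ b ag p = p ∘ Sat-cong R φ b (Agree-sym ag)

    HonestQuant-cong : ∀ s x φ {r r′} a → varsᶠ φ ≤ N → Agree N r r′ →
                       HonestQuant s x φ r a → HonestQuant s x φ r′ a
    HonestQuant-cong s x φ zero b ag p c =
      p c ∘ Signed-cong s φ b (Agree-update c x (Agree-sym ag))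
    HonestQuant-cong s x φ (suc c) b ag p = Signed-cong s φ b (Agree-update c x ag) p

    honest-rel : ∀ j v → ∃ (Honest (relKey j v))
    honest-rel j v = proj₁ answer , rels , λ s x φ r _ eq → ⊥-elim (relKey≢quantKey j v s x φ r eq)
      where
      answer : ∃ (HonestRel j v)
      answer with em {T (R j v)}
      ... | yes t = 1 , t
      ... | no ¬t = 0 , ¬t
      rels : ∀ j′ v′ → relKey j v ≡ relKey j′ v′ → HonestRel j′ v′ (proj₁ answer)
      rels j′ v′ eq with relKey-injective {j} {v} {j′} {v′} eq
      ... | refl = proj₂ answer

    honest-quant : ∀ s x φ r → ∃ (Honest (quantKey s x φ r))
    honest-quant s x φ r = proj₁ answer , (λ j v eq → ⊥-elim (relKey≢quantKey j v s x φ r (sym eq))) , quants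
      where
      answer : ∃ (HonestQuant s x φ r)
      answer with em {∃ λ b → Signed s (Sat R (r [ b / x ]) φ)}
      ... | yes (b , p) = suc b , p
      ... | no ¬p = 0 , λ b p → ¬p (b , p)
      quants : ∀ s′ x′ φ′ r′ → varsᶠ φ′ ≤ N → quantKey s x φ r ≡ quantKey s′ x′ φ′ r′ →
               HonestQuant s′ x′ φ′ r′ (proj₁ answer)
      quants s′ x′ φ′ r′ b eq with quantKey-injective {s} {x} {φ} {r} {s′} {x′} {φ′} {r′} eq
      ... | (refl , refl , refl) , ag = HonestQuant-cong s x φ (proj₁ answer) b ag (proj₂ answer)

    honest-answer : ∀ q → ∃ (Honest q)
    honest-answer q with em {Σ _ λ j → Σ _ λ v → q ≡ relKey j v}
    ... | yes (j , v , refl) = honest-rel j v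
    ... | no ¬rel with em {Σ _ λ s → Σ _ λ x → Σ _ λ φ → Σ _ λ r → q ≡ quantKey s x φ r}
    ...   | yes (s , x , φ , r , refl) = honest-quant s x φ r
    ...   | no ¬quant = 0 , (λ j v eq → ⊥-elim (¬rel (j , v , eq))) ,
                            λ s x φ r _ eq → ⊥-elim (¬quant (s , x , φ , r , eq))

    HonestHistory : ℕ → Set
    HonestHistory h = ∀ {q a} → pair q a ∈ʰ h → Honest q a

    honest-cons : ∀ {h q a} → HonestHistory h → Honest q a → HonestHistory (cons h (pair q a))
    honest-cons hon new m with ∈ʰ-cons⁻ m
    ... | inj₂ m′ = hon m′
    ... | inj₁ eq with pair-injective eq
    ...   | refl , refl = new

    honest-[] : HonestHistory 0
    honest-[] (here ())
    honest-[] (there () _)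

    Signed-flip : ∀ s {A : Set} → Signed s A → Signed (flip s) A → ⊥
    Signed-flip pos a ¬a = ¬a a
    Signed-flip neg ¬a a = ¬a a

    module _ {h : ℕ} (hon : HonestHistory h) where

      -- Only the connectives recurse; relation atoms and quantified formulas are settled at once by
      -- the honest entry in the history.
      honest-ev : ∀ s r φ → varsᶠ φ ≤ N → Ev h s r φ → Signed s (Sat R r φ)
      honest-ev s r (t ≐ u) b p = p
      honest-ev s r (t ≺ u) b p = p
      honest-ev s r falsum b p = p
      honest-ev pos r (rel j ts) b (w , m) = proj₁ (hon m) j (values ts r) refl
      honest-ev neg r (rel j ts) b m = proj₁ (hon m) j (values ts r) refl
      honest-ev pos r (¬ᶠ φ) b p = honest-ev neg r φ b p
      honest-ev neg r (¬ᶠ φ) b p ¬q = ¬q (honest-ev pos r φ b p)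
      honest-ev pos r (φ ∧ᶠ ψ) b (p , q) =
        honest-ev pos r φ (⊔≤ˡ b) p , honest-ev pos r ψ (⊔≤ʳ {varsᶠ φ} b) q
      honest-ev neg r (φ ∧ᶠ ψ) b (inj₁ p) (p′ , _) = honest-ev neg r φ (⊔≤ˡ b) p p′
      honest-ev neg r (φ ∧ᶠ ψ) b (inj₂ q) (_ , q′) = honest-ev neg r ψ (⊔≤ʳ {varsᶠ φ} b) q q′
      honest-ev pos r (φ ∨ᶠ ψ) b (inj₁ p) = inj₁ (honest-ev pos r φ (⊔≤ˡ b) p)
      honest-ev pos r (φ ∨ᶠ ψ) b (inj₂ q) = inj₂ (honest-ev pos r ψ (⊔≤ʳ {varsᶠ φ} b) q)
      honest-ev neg r (φ ∨ᶠ ψ) b (p , q) (inj₁ p′) = honest-ev neg r φ (⊔≤ˡ b) p p′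
      honest-ev neg r (φ ∨ᶠ ψ) b (p , q) (inj₂ q′) = honest-ev neg r ψ (⊔≤ʳ {varsᶠ φ} b) q q′
      honest-ev pos r (∃ᶠ x φ) b (w , m) = w , proj₂ (hon m) pos x φ r (⊔≤ʳ {suc x} b) refl
      honest-ev neg r (∃ᶠ x φ) b m (a , p) = proj₂ (hon m) pos x φ r (⊔≤ʳ {suc x} b) refl a p
      honest-ev pos r (∀ᶠ x φ) b m a = stable (proj₂ (hon m) neg x φ r (⊔≤ʳ {suc x} b) refl a)
      honest-ev neg r (∀ᶠ x φ) b (w , m) p = proj₂ (hon m) neg x φ r (⊔≤ʳ {suc x} b) refl (p w)

      honest-unrefuted : ∀ s x φ r → varsᶠ φ ≤ N → ¬ Refuted h s x φ r
      honest-unrefuted s x φ r b (c , inj₁ (m , p)) =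
        proj₂ (hon m) s x φ r b refl c (honest-ev s _ φ b p)
      honest-unrefuted s x φ r b (c , inj₂ (m , p)) =
        Signed-flip s (proj₂ (hon m) s x φ r b refl) (honest-ev (flip s) _ φ b p)

    honest-consistent : ∀ φ e r → varsᶠ φ ≤ N → HonestHistory (r 0) →
                        ¬ Win (step ⟨ inconsistent φ , e , r , pos ⟩)
    honest-consistent (¬ᶠ φ) e r b hon w = honest-consistent φ e r b hon w
    honest-consistent (φ ∧ᶠ ψ) e r b hon (left w) = honest-consistent φ e r (⊔≤ˡ b) hon w
    honest-consistent (φ ∧ᶠ ψ) e r b hon (right w) =
      honest-consistent ψ e r (⊔≤ʳ {varsᶠ φ} b) hon w
    honest-consistent (φ ∨ᶠ ψ) e r b hon (left w) = honest-consistent φ e r (⊔≤ˡ b) hon w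
    honest-consistent (φ ∨ᶠ ψ) e r b hon (right w) =
      honest-consistent ψ e r (⊔≤ʳ {varsᶠ φ} b) hon w
    honest-consistent (∃ᶠ x φ) e r b hon (left w) =
      honest-unrefuted hon pos x φ (unshift r) (⊔≤ʳ {suc x} b) (to (Win-refuted pos x φ e r) w)
    honest-consistent (∃ᶠ x φ) e r b hon (right w) = honest-consistent φ e r (⊔≤ʳ {suc x} b) hon w
    honest-consistent (∀ᶠ x φ) e r b hon (left w) =
      honest-unrefuted hon neg x φ (unshift r) (⊔≤ʳ {suc x} b) (to (Win-refuted neg x φ e r) w)
    honest-consistent (∀ᶠ x φ) e r b hon (right w) = honest-consistent φ e r (⊔≤ʳ {suc x} b) hon w

    module _ (ψ : Fm) (b : varsᶠ ψ ≤ N) where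
      private
        E : Env
        E = bind 0 (round ψ) ε ε

      mutual
        -- Induction on the winning derivation, with the invariant that the history is honest and
        -- `ψ` is false. Abelard replies with `honest-answer`, and the loop changes only game
        -- variables, so falsity of `ψ` carries over.
        round-lost : ∀ r → HonestHistory (r 0) → ¬ Sat R (unshift r) ψ →
                     ¬ Win (step ⟨ lab 0 (round ψ) , ε , r , pos ⟩)
        round-lost r hon ¬ψ (move (left (left w))) =
          ¬ψ (honest-ev hon pos (unshift r) ψ b (Win-ev⁻ E r pos ψ w))
        round-lost r hon ¬ψ (move (left (right w))) with Win-∃ˢ*⁻ N (inconsistent ψ) E r w
        ... | r′ , eq , w′ = honest-consistent ψ E r′ b (subst HonestHistory (sym eq) hon) w′
        round-lost r hon ¬ψ (move (right (some q (every w)))) =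
          continue-lost ((r [ q / 5 ]) [ proj₁ (honest-answer q) / 6 ]) hon
                        (proj₂ (honest-answer q)) ¬ψ (w (proj₁ (honest-answer q)))

        continue-lost : ∀ r → HonestHistory (r 0) → Honest (r 5) (r 6) → ¬ Sat R (unshift r) ψ →
                        ¬ Win (step ⟨ record-and-continue , E , r , pos ⟩)
        continue-lost r hon new ¬ψ (some u (both w (some h (both w′ (move w″))))) =
          round-lost ((r [ u / 7 ]) [ h / 0 ])
            (subst HonestHistory (sym h≡) (honest-cons hon new)) ¬ψ w″
          where
          h≡ : h ≡ cons (r 0) (pair (r 5) (r 6))
          h≡ = trans (Win-≐⁻ (var 0) (var 7) E ((r [ u / 7 ]) [ h / 0 ]) pos w′)
                (trans (Win-≐⁻ (var 7) (consᵗ (var 0) (pairᵗ (var 5) (var 6))) E (r [ u / 7 ]) pos w)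
                       (⟦entryᵗ⟧ (r [ u / 7 ])))

  Refuted-cong : ∀ {h} s x φ {r r′} → varsᶠ φ ≤ N → Agree N r r′ →
                 Refuted h s x φ r → Refuted h s x φ r′
  Refuted-cong {h} s x φ b ag (c , inj₁ (m , p)) =
    c , inj₁ (subst (λ k → pair k 0 ∈ʰ h) (quantKey-cong s x φ ag) m ,
              Ev-cong s φ b (Agree-update c x ag) p)
  Refuted-cong {h} s x φ b ag (c , inj₂ (m , p)) =
    c , inj₂ (subst (λ k → pair k (suc c) ∈ʰ h) (quantKey-cong s x φ ag) m ,
              Ev-cong (flip s) φ b (Agree-update c x ag) p)

  -- If Eloise does not win, then asking question n in round n yields answers
  -- that are never caught inconsistent, hence describe a relation falsifying ψ.

  module Complete (em : ExcludedMiddle 0ℓ) (ψ : Fm) (r₀ : Assignment)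
                  (¬w₀ : ¬ Win (step ⟨ lab 0 (round ψ) , ε , r₀ , pos ⟩)) where
    open Games em using (stable; ¬∀⇒∃¬)

    E : Env
    E = bind 0 (round ψ) ε ε

    State : Set
    State = Σ Assignment λ r → ¬ Win (step ⟨ lab 0 (round ψ) , ε , r , pos ⟩)

    reply : ∀ q ((r , _) : State) →
            ∃ λ a → ¬ Win (step ⟨ record-and-continue , E , (r [ q / 5 ]) [ a / 6 ] , pos ⟩)
    reply q (r , ¬w) = ¬∀⇒∃¬ λ w → ¬w (move (right (some q (every w))))

    next : ℕ → State → State
    next q (r , ¬w) = r₂ [ u / 0 ] , λ w → proj₂ (reply q (r , ¬w))
      (some u (both (Win-≐ (var 7) (consᵗ (var 0) (pairᵗ (var 5) (var 6))) E r₂ pos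
                           (sym (⟦entryᵗ⟧ r₂)))
              (some u (both (Win-≐ (var 0) (var 7) E (r₂ [ u / 0 ]) pos refl) (move w)))))
      where
      a = proj₁ (reply q (r , ¬w))
      u = cons (r 0) (pair q a)
      r₂ = ((r [ q / 5 ]) [ a / 6 ]) [ u / 7 ]

    state : ℕ → State
    state zero = r₀ , ¬w₀
    state (suc n) = next n (state n)

    asg : ℕ → Assignment
    asg n = proj₁ (state n)

    hist : ℕ → ℕ
    hist n = asg n 0

    answer : ℕ → ℕ
    answer n = proj₁ (reply n (state n))

    hist-suc : ∀ n → hist (suc n) ≡ cons (hist n) (pair n (answer n))
    hist-suc n = refl

    unshift-asg : ∀ n → unshift (asg n) ≡ unshift r₀
    unshift-asg zero = refl
    unshift-asg (suc n) = unshift-asg n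

    hist-mono : ∀ {m n} → m ≤ n → ∀ {x} → x ∈ʰ hist m → x ∈ʰ hist n
    hist-mono {n = zero} z≤n p = p
    hist-mono {n = suc n} m≤1+n p with m≤n⇒m<n∨m≡n m≤1+n
    ... | inj₁ (s≤s m≤n) = there (hist-suc n) (hist-mono m≤n p)
    ... | inj₂ refl = p

    answer-recorded : ∀ q → pair q (answer q) ∈ʰ hist (suc q)
    answer-recorded q = here (hist-suc q)

    answer-is : ∀ {q a} → answer q ≡ a → pair q a ∈ʰ hist (suc q)
    answer-is {q} eq = subst (λ a → pair q a ∈ʰ hist (suc q)) eq (answer-recorded q)

    positive : ℕ → Bool
    positive zero = false
    positive (suc _) = true

    R : RelAsg ar
    R j v = positive (answer (relKey j v))

    rel-answered : ∀ s q {a} → answer q ≡ a → Signed s (T (positive a)) →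
                   Answered (hist (suc q)) s q
    rel-answered pos q {suc w} eq p = w , answer-is eq
    rel-answered neg q {zero} eq p = answer-is eq
    rel-answered neg q {suc w} eq p = ⊥-elim (p tt)

    -- The converse of honesty: whatever holds of the extracted relation is established by a finite
    -- stage of the history.
    Evaluable : Fm → Set
    Evaluable φ = ∀ s r → Signed s (Sat R r φ) → ∃ λ n → Ev (hist n) s r φ

    Unrefuted : Sign → ℕ → Fm → Set
    Unrefuted s x φ = ∀ n r → ¬ Refuted (hist n) s x φ r

    -- All `r` are covered because subformulas get evaluated under changed assignments; `r′` matches
    -- `r` only below `N`, which is what `Win-∃ˢ*` provides.
    Consistent : Fm → Set
    Consistent φ = ∀ n r → Σ Assignment λ r′ →
      r′ 0 ≡ hist n × Agree N r (unshift r′) × ¬ Win (step ⟨ inconsistent φ , E , r′ , pos ⟩)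

    weaken : ∀ {φ χ} → Consistent φ →
             (∀ r → Win (step ⟨ inconsistent χ , E , r , pos ⟩) →
                    Win (step ⟨ inconsistent φ , E , r , pos ⟩)) → Consistent χ
    weaken con f n r with con n r
    ... | r′ , eq , ag , ¬w = r′ , eq , ag , ¬w ∘ f r′

    unrefuted : ∀ {φ} s x χ → varsᶠ χ ≤ N → Consistent φ →
                (∀ r → Win (step ⟨ refuted s x χ , E , r , pos ⟩) →
                       Win (step ⟨ inconsistent φ , E , r , pos ⟩)) → Unrefuted s x χ
    unrefuted s x χ b con f n r ref with con n r
    ... | r′ , eq , ag , ¬w = ¬w (f r′ (from (Win-refuted s x χ E r′)
            (subst (λ h → Refuted h s x χ (unshift r′)) (sym eq) (Refuted-cong s x χ b ag ref))))

    Ev-later : ∀ {m n s r} φ → m ≤ n → Ev (hist m) s r φ → Ev (hist n) s r φ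
    Ev-later {s = s} {r} φ m≤n = Ev-mono s r φ (hist-mono m≤n)

    Signed-¬ : ∀ s {A : Set} → ¬ Signed s A → Signed (flip s) A
    Signed-¬ pos ¬a = ¬a
    Signed-¬ neg ¬¬a = stable ¬¬a

    module _ (s : Sign) (x : ℕ) (φ : Fm) (evaluable : Evaluable φ)
             (unref : Unrefuted s x φ) (r : Assignment) where
      private
        q : ℕ
        q = quantKey s x φ r

      -- A wrong no would be refuted by a true instance, and a wrong yes by its failing witness, as
      -- soon as that instance has been evaluated at some finite stage.
      quant-answered : ∀ s′ {a} → answer q ≡ a →
                       Signed s′ (∃ λ b → Signed s (Sat R (r [ b / x ]) φ)) →
                       Answered (hist (suc q)) s′ q
      quant-answered pos {zero} eq (b , p) with evaluable s (r [ b / x ]) p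
      -- By stage `suc q ⊔ n` both the answer to `q` and the evaluation of the instance are on
      -- record.
      ... | n , pe = ⊥-elim (unref (suc q ⊔ n) r (b , inj₁
              (hist-mono (m≤m⊔n (suc q) n) (answer-is eq) , Ev-later φ (m≤n⊔m (suc q) n) pe)))
      quant-answered pos {suc w} eq p = w , answer-is eq
      quant-answered neg {zero} eq p = answer-is eq
      quant-answered neg {suc b} eq p
        with evaluable (flip s) (r [ b / x ]) (Signed-¬ s λ c → p (b , c))
      ... | n , pe = ⊥-elim (unref (suc q ⊔ n) r (b , inj₂
              (hist-mono (m≤m⊔n (suc q) n) (answer-is eq) , Ev-later φ (m≤n⊔m (suc q) n) pe)))

    Ev-both : ∀ {s r} φ χ → (∃ λ n → Ev (hist n) s r φ) → (∃ λ n → Ev (hist n) s r χ) →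
              ∃ λ n → Ev (hist n) s r φ × Ev (hist n) s r χ
    Ev-both φ χ (m , p) (n , q) = m ⊔ n , Ev-later φ (m≤m⊔n m n) p , Ev-later χ (m≤n⊔m m n) q

    evaluate : ∀ φ → varsᶠ φ ≤ N → Consistent φ → Evaluable φ
    evaluate (t ≐ u) b con s r p = 0 , p
    evaluate (t ≺ u) b con s r p = 0 , p
    evaluate falsum b con s r p = 0 , p
    evaluate (rel j ts) b con s r p =
      -- Question `q` is asked in round `q`, so its answer first appears in `hist (suc q)`.
      suc (relKey j (values ts r)) , rel-answered s (relKey j (values ts r)) refl p
    evaluate (¬ᶠ φ) b con pos r p = evaluate φ b con neg r p
    evaluate (¬ᶠ φ) b con neg r p = evaluate φ b con pos r (stable p)
    evaluate (φ ∧ᶠ χ) b con pos r (p , q) = Ev-both φ χ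
      (evaluate φ (⊔≤ˡ b) (weaken {φ ∧ᶠ χ} {φ} con λ _ → left) pos r p)
      (evaluate χ (⊔≤ʳ {varsᶠ φ} b) (weaken {φ ∧ᶠ χ} {χ} con λ _ → right) pos r q)
    evaluate (φ ∧ᶠ χ) b con neg r ¬p with em {Sat R r φ}
    ... | no ¬φ = map₂ inj₁
      (evaluate φ (⊔≤ˡ b) (weaken {φ ∧ᶠ χ} {φ} con λ _ → left) neg r ¬φ)
    ... | yes p = map₂ inj₂
      (evaluate χ (⊔≤ʳ {varsᶠ φ} b) (weaken {φ ∧ᶠ χ} {χ} con λ _ → right) neg r λ q → ¬p (p , q))
    evaluate (φ ∨ᶠ χ) b con pos r (inj₁ p) = map₂ inj₁
      (evaluate φ (⊔≤ˡ b) (weaken {φ ∨ᶠ χ} {φ} con λ _ → left) pos r p)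
    evaluate (φ ∨ᶠ χ) b con pos r (inj₂ q) = map₂ inj₂
      (evaluate χ (⊔≤ʳ {varsᶠ φ} b) (weaken {φ ∨ᶠ χ} {χ} con λ _ → right) pos r q)
    evaluate (φ ∨ᶠ χ) b con neg r ¬p = Ev-both φ χ
      (evaluate φ (⊔≤ˡ b) (weaken {φ ∨ᶠ χ} {φ} con λ _ → left) neg r (¬p ∘ inj₁))
      (evaluate χ (⊔≤ʳ {varsᶠ φ} b) (weaken {φ ∨ᶠ χ} {χ} con λ _ → right) neg r (¬p ∘ inj₂))
    evaluate (∃ᶠ x φ) b con s r p = suc (quantKey pos x φ r) , quant-answered pos x φ
      (evaluate φ b′ (weaken {∃ᶠ x φ} {φ} con λ _ → right))
      (unrefuted {∃ᶠ x φ} pos x φ b′ con λ _ → left) r s refl p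
      where b′ = ⊔≤ʳ {suc x} b
    evaluate (∀ᶠ x φ) b con s r p = suc (quantKey neg x φ r) , quant-answered neg x φ
      (evaluate φ b′ (weaken {∀ᶠ x φ} {φ} con λ _ → right))
      (unrefuted {∀ᶠ x φ} neg x φ b′ con λ _ → left) r (flip s) refl (counterexample s p)
      where
      b′ = ⊔≤ʳ {suc x} b
      counterexample : ∀ s → Signed s (∀ a → Sat R (r [ a / x ]) φ) →
                       Signed (flip s) (∃ λ a → ¬ Sat R (r [ a / x ]) φ)
      counterexample pos p (a , ¬p) = ¬p (p a)
      counterexample neg ¬p = ¬∀⇒∃¬ ¬p

    ψ-consistent : Consistent ψ
    ψ-consistent n r with Win-∃ˢ* N (inconsistent ψ) E (asg n) r
    ... | r′ , eq , ag , k = r′ , eq , ag , λ w → proj₂ (state n) (move (left (right (k w))))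

    ψ-false : varsᶠ ψ ≤ N → ¬ Sat R (unshift r₀) ψ
    ψ-false b p with evaluate ψ b ψ-consistent pos (unshift r₀) p
    ... | n , pe = proj₂ (state n) (move (left (left (Win-ev E (asg n) pos ψ
            (subst (λ r → Ev (hist n) pos r ψ) (sym (unshift-asg n)) pe)))))

  Win-game : ExcludedMiddle 0ℓ → ∀ ψ → varsᶠ ψ ≤ N → ∀ r →
             Win (step ⟨ game ψ , ε , r , pos ⟩) ⇔ SatΠ¹₁ (unshift r) ψ
  Win-game em ψ b r = mk⇔
    (λ w R → stable λ ¬p → Sound.round-lost em R ψ b (r [ 0 / 0 ]) (Sound.honest-[] em R) ¬p
      (Win-let⁻ 0 𝟘 (lab 0 (round ψ)) ε r 0 (λ _ → refl) w))
    (λ p → Win-let 0 𝟘 (lab 0 (round ψ)) ε r 0 (λ _ → refl)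
      -- The expected type fixes the omitted relation as the `R` extracted from Abelard's answers.
      (stable λ ¬w → Complete.ψ-false em ψ (r [ 0 / 0 ]) ¬w b (p _)))
    where open Games em using (stable)

-- Copying downwards never reads a variable that was already overwritten.

copying : ℕ → SCL → SCL
copying zero φ = φ
copying (suc n) φ = ∃ˢ (8 + n) ((var (8 + n) ≐ var n) ∧ˢ copying n φ)

copied : ℕ → Assignment → Assignment
copied zero r = r
copied (suc n) r = copied n (r [ r n / 8 + n ])

Win-copying : ∀ n φ e r → Win (step ⟨ copying n φ , e , r , pos ⟩) ⇔
                          Win (step ⟨ φ , e , copied n r , pos ⟩)
Win-copying zero φ e r = mk⇔ id id
Win-copying (suc n) φ e r = mk⇔
  (to (Win-copying n φ e _) ∘ Win-let⁻ (8 + n) (var n) (copying n φ) e r (r n) unread)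
  (Win-let (8 + n) (var n) (copying n φ) e r (r n) unread ∘ from (Win-copying n φ e _))
  where
  unread : ∀ a → (r [ a / 8 + n ]) n ≡ r n
  unread a = update-other r a (m≢1+n+m n)

copied-≥ : ∀ n r {i} → n ≤ i → copied n r (8 + i) ≡ r (8 + i)
copied-≥ zero r n≤i = refl
copied-≥ (suc n) r {i} n<i =
  trans (copied-≥ n _ (<⇒≤ n<i)) (update-other (unshift r) (r n) (<⇒≢ n<i ∘ sym))

copied-< : ∀ n r → Agree n (unshift (copied n r)) r
copied-< (suc n) r {i} i<1+n with m≤n⇒m<n∨m≡n i<1+n
... | inj₁ (s≤s i<n) = trans (copied-< n _ i<n) (update-other r (r n) i≢8+n)
  where
  i≢8+n : i ≢ 8 + n
  i≢8+n = <⇒≢ (<-≤-trans i<n (m≤n+m n 8))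
... | inj₂ refl = trans (copied-≥ n _ ≤-refl) (update-same (unshift r) (r n) n)

Π¹₁⇒SCL : ExcludedMiddle 0ℓ → ∀ k X → IsΠ¹₁ k X → SCLDefinable k X
Π¹₁⇒SCL em k X (ar , ψ , _ , def) =
  -- Zeroing goes outside copying, since copying reads all variables below `N`, possibly beyond the
  -- tuple. Those variables are 0 under `tupleAsg` anyway, so the prefix changes no value and only
  -- binds them.
  zeroedˢ k n φ , zeroedˢ-free k n φ (m≤n+m n k) id , λ m →
    meaning m ⇔-∘ def m
  where
  N = varsᶠ ψ
  φ = copying N (FromΠ¹₁.game N ψ)
  n = varsˢ φ
  meaning : ∀ m → SatΠ¹₁ (tupleAsg m) ψ ⇔ (tupleAsg m ⊨ˢ zeroedˢ k n φ)
  meaning m = mk⇔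
    (λ p → from strategy (from reduce (from play λ R → Sat-cong R ψ ≤-refl (Agree-sym ag) (p R))))
    (λ σ R → Sat-cong R ψ ≤-refl ag (to play (to reduce (to strategy σ)) R))
    where
    r = zeros k n (tupleAsg m)
    strategy = Games.winning⇔Win em ⟨ zeroedˢ k n φ , ε , tupleAsg m , pos ⟩
    reduce = Win-copying N (FromΠ¹₁.game N ψ) ε r ⇔-∘ Win-zeroed k n φ ε (tupleAsg m)
    play = FromΠ¹₁.Win-game N em ψ ≤-refl (copied N r)
    ag : Agree N (unshift (copied N r)) (tupleAsg m)
    ag {i} i<N = trans (copied-< N r i<N) (zeros-id k n (tupleAsg m) (tupleAsg-zero m) i)

theorem7p2 : ExcludedMiddle 0ℓ →
    (k : ℕ) (X : Vec ℕ k → Set) → SCLDefinable k X ⇔ IsΠ¹₁ k X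
theorem7p2 em k X = mk⇔ (SCL⇒Π¹₁ em k X) (Π¹₁⇒SCL em k X)
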